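{- For $s \in (0,1)$ and $n \ge 1$, let $\mathbf{G} \sim G(n,1/2)$ and let $\mathbf{G}'$ be the random graph obtained from $\mathbf{G}$ by re-sampling each edge independently with probability $s$. Let $\mu_{\mathbf{G}}, \mu_{\mathbf{G}'}$ denote the hardcore models at fugacity $\lambda = 1$ on $\mathbf{G}, \mathbf{G}'$ respectively, and let $w_2$ be the normalized $2$-Wasserstein distance. Then $$\lim_{s \to 0}\ \liminf_{n \to \infty}\ \mathbb{E}_{\mathbf{G},\mathbf{G}'}\left[ w_2(\mu_{\mathbf{G}},\mu_{\mathbf{G}'})^2 \right] = 2.$$
   Context: $G(n,1/2)$ is the Erdős–Rényi random graph on vertex set $[n]=\{1,\dots,n\}$, each of the $\binom n2$ potential edges being present independently with probability $1/2$. Re-sampling each edge with probability $s$ means: independently for each unordered pair of vertices, with probability $s$ the edge indicator of that pair is replaced by a fresh independent Bernoulli$(1/2)$ variable, and otherwise it is left unchanged; equivalently, each pair's edge indicator is flipped independently with probability $s/2$. The hardcore model on a graph $G$ with vertex set $[n]$ at fugacity $\lambda=1$ is the uniform distribution $\mu_G$ over all independent sets of $G$ (including the empty set). It is regarded as a probability measure on $\{0,1\}^n \subset \mathbb{R}^n$ by identifying a set $S\subseteq[n]$ with its indicator vector. For probability measures $\mu,\nu$ on a Euclidean space with norm $\|\cdot\|$, the normalized $2$-Wasserstein distance is $$w_2(\mu,\nu) = \inf_{\pi \in C(\mu,\nu)} \sqrt{ \mathbb{E}_{(X,Y)\sim\pi} \left\| \frac{X}{\sqrt{\mathbb{E}_{X\sim\mu}\|X\|^2}}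 - \frac{Y}{\sqrt{\mathbb{E}_{Y\sim\nu}\|Y\|^2}} \right\|^2 },$$ where $C(\mu,\nu)$ is the set of all couplings of $\mu$ and $\nu$. -}

module Defs where

open import Algebra.Bundles using (CommutativeRing)
import Algebra.Properties.Ring as RingProperties
import Algebra.Properties.Semiring.Sum as SemiringSum
open import Data.Bool.Base using (Bool; true; false; if_then_else_; T)
open import Data.Bool.Properties using (T?)
open import Data.Fin.Base using (Fin; zero; suc)
import Data.Fin.Properties as Fin
open import Data.Fin.Subset using (Subset; Side; inside; outside; _∈_; ⊥)
open import Data.Fin.Subset.Properties using (_∈?_; ∉⊥)
open import Data.Nat.Base using (ℕ; zero; suc) renaming (_≤_ to _≤ℕ_)
open import Data.Product.Base using (∃; _×_; _,_; proj₁; proj₂)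
open import Data.Sum.Base using (inj₁; inj₂)
open import Data.Vec.Base using ([]; _∷_; lookup)
open import Data.Vec.Functional using (Vector)
open import Level using (Level; _⊔_) renaming (suc to lsuc)
open import Relation.Binary.Core using (Rel)
open import Relation.Binary.PropositionalEquality.Core as ≡ using (_≡_)
import Relation.Binary.Construct.NonStrictToStrict as ToStrict
open import Relation.Binary.Structures using (IsDecTotalOrder)
open import Relation.Nullary.Decidable using (Dec; yes; no; does; _→-dec_; ¬?; dec-true)
open import Relation.Nullary.Negation using (¬_; contradiction)
open import Relation.Unary using (Pred)

module Bounds {a ℓ} {A : Set a} (_≤_ : Rel A ℓ) where

  UpperBound LowerBound : ∀ {p} → Pred A p → A → Set (a ⊔ ℓ ⊔ p)
  UpperBound P x = ∀ y → P y → y ≤ x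
  LowerBound P x = ∀ y → P y → x ≤ y

  IsSupremum IsInfimum : ∀ {p} → Pred A p → A → Set (a ⊔ ℓ ⊔ p)
  IsSupremum P x = UpperBound P x × (∀ y → UpperBound P y → x ≤ y)
  IsInfimum  P x = LowerBound P x × (∀ y → LowerBound P y → y ≤ x)

-- The real numbers.  The library has no reals, so they enter through their
-- usual classical axioms, which determine them up to isomorphism: a totally
-- ordered field in which every inhabited set that is bounded above has a
-- supremum.  Trichotomy is taken in its classical, decidable form.
record CompleteOrderedField (c ℓ₁ ℓ₂ : Level) : Set (lsuc (c ⊔ ℓ₁ ⊔ ℓ₂)) where
  field
    commutativeRing : CommutativeRing c ℓ₁

  open CommutativeRing commutativeRing public

  infix 4 _≤_
  field
    0≉1             : 0# ≉ 1#
    invertible      : ∀ x → x ≉ 0# → ∃ λ y → x * y ≈ 1#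
    _≤_             : Rel Carrier ℓ₂
    isDecTotalOrder : IsDecTotalOrder _≈_ _≤_
    +-monoˡ-≤       : ∀ {x y} z → x ≤ y → x + z ≤ y + z
    *-nonNegative   : ∀ {x y} → 0# ≤ x → 0# ≤ y → 0# ≤ x * y

  open Bounds _≤_ public

  field
    supremum : (P : Pred Carrier (c ⊔ ℓ₁ ⊔ ℓ₂)) →
               ∃ P → ∃ (UpperBound P) → ∃ (IsSupremum P)

-- A simple graph on Fin n is its strictly triangular array of edge
-- indicators, one Boolean for each unordered pair.  In G ▷ N the vertices of
-- G are relabelled by suc, and the additional vertex zero has neighbourhood N.
infixl 5 _▷_
data Graph : ℕ → Set where
  ∅   : Graph 0
  _▷_ : ∀ {n} → Graph n → Subset n → Graph (suc n)

adjacent : ∀ {n} → Graph n → Fin n → Fin n → Bool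
adjacent (G ▷ N) zero    zero    = false
adjacent (G ▷ N) zero    (suc j) = lookup N j
adjacent (G ▷ N) (suc i) zero    = lookup N i
adjacent (G ▷ N) (suc i) (suc j) = adjacent G i j

adjacent-irrefl : ∀ {n} (G : Graph n) i → adjacent G i i ≡ false
adjacent-irrefl (G ▷ N) zero    = ≡.refl
adjacent-irrefl (G ▷ N) (suc i) = adjacent-irrefl G i

adjacent-sym : ∀ {n} (G : Graph n) i j → adjacent G i j ≡ adjacent G j i
adjacent-sym (G ▷ N) zero    zero    = ≡.refl
adjacent-sym (G ▷ N) zero    (suc j) = ≡.refl
adjacent-sym (G ▷ N) (suc i) zero    = ≡.refl
adjacent-sym (G ▷ N) (suc i) (suc j) = adjacent-sym G i j

Independent : ∀ {n} → Graph n → Subset n → Set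
Independent G S = ∀ i → i ∈ S → ∀ j → j ∈ S → ¬ T (adjacent G i j)

independent? : ∀ {n} (G : Graph n) (S : Subset n) → Dec (Independent G S)
independent? G S =
  Fin.all? λ i → (i ∈? S) →-dec Fin.all? λ j → (j ∈? S) →-dec ¬? (T? (adjacent G i j))

∅-independent : ∀ {n} (G : Graph n) → Independent G ⊥
∅-independent G i i∈⊥ = contradiction i∈⊥ ∉⊥

module Real {c ℓ₁ ℓ₂} (ℝ : CompleteOrderedField c ℓ₁ ℓ₂) where

  open CompleteOrderedField ℝ public
  open ToStrict _≈_ _≤_ public using (_<_)
  open SemiringSum semiring public using (sum)

  private
    module ≤ = IsDecTotalOrder isDecTotalOrder
    module R = RingProperties ring

    r : Level
    r = c ⊔ ℓ₁ ⊔ ℓ₂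

  +-monoʳ-≤ : ∀ {x y} z → x ≤ y → z + x ≤ z + y
  +-monoʳ-≤ {x} {y} z x≤y =
    ≤.trans (≤.reflexive (+-comm z x)) (≤.trans (+-monoˡ-≤ z x≤y) (≤.reflexive (+-comm y z)))

  +-nonNegative : ∀ {x y} → 0# ≤ x → 0# ≤ y → 0# ≤ x + y
  +-nonNegative {x} {y} 0≤x 0≤y =
    ≤.trans 0≤y (≤.trans (≤.reflexive (sym (+-identityˡ y))) (+-monoˡ-≤ y 0≤x))

  x≤x+y : ∀ x {y} → 0# ≤ y → x ≤ x + y
  x≤x+y x 0≤y = ≤.trans (≤.reflexive (sym (+-identityʳ x))) (+-monoʳ-≤ x 0≤y)

  x≤y+x : ∀ x {y} → 0# ≤ y → x ≤ y + x
  x≤y+x x {y} 0≤y = ≤.trans (x≤x+y x 0≤y) (≤.reflexive (+-comm x y))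

  x≤y⇒0≤y-x : ∀ {x y} → x ≤ y → 0# ≤ y - x
  x≤y⇒0≤y-x {x} x≤y = ≤.trans (≤.reflexive (sym (-‿inverseʳ x))) (+-monoˡ-≤ (- x) x≤y)

  0≤y-x⇒x≤y : ∀ {x y} → 0# ≤ y - x → x ≤ y
  0≤y-x⇒x≤y {x} {y} 0≤y-x = ≤.trans (x≤y+x x 0≤y-x)
    (≤.reflexive (trans (+-assoc y (- x) x) (trans (+-congˡ (-‿inverseˡ x)) (+-identityʳ y))))

  x≤0⇒0≤-x : ∀ {x} → x ≤ 0# → 0# ≤ - x
  x≤0⇒0≤-x {x} x≤0 = ≤.trans (x≤y⇒0≤y-x x≤0) (≤.reflexive (+-identityˡ (- x)))

  0≤x² : ∀ x → 0# ≤ x * x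
  0≤x² x with ≤.total 0# x
  ... | inj₁ 0≤x = *-nonNegative 0≤x 0≤x
  ... | inj₂ x≤0 = ≤.trans (*-nonNegative (x≤0⇒0≤-x x≤0) (x≤0⇒0≤-x x≤0)) (≤.reflexive
    (trans (sym (R.-‿distribˡ-* x (- x)))
      (trans (-‿cong (sym (R.-‿distribʳ-* x x))) (R.-‿involutive (x * x)))))

  0≤1 : 0# ≤ 1#
  0≤1 = ≤.trans (0≤x² 1#) (≤.reflexive (*-identityˡ 1#))

  1≰0 : ¬ 1# ≤ 0#
  1≰0 1≤0 = 0≉1 (≤.antisym 0≤1 1≤0)

  2# : Carrier
  2# = 1# + 1#

  infix 8 _⁻¹ _²

  _² : Carrier → Carrier
  x ² = x * x

  -- Total inverse, with the junk value 0 at 0.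
  _⁻¹ : Carrier → Carrier
  x ⁻¹ with x ≤.≟ 0#
  ... | yes _  = 0#
  ... | no x≉0 = proj₁ (invertible x x≉0)

  *-⁻¹-inverse : ∀ x → x ≉ 0# → x * x ⁻¹ ≈ 1#
  *-⁻¹-inverse x x≉0 with x ≤.≟ 0#
  ... | yes x≈0 = contradiction x≈0 x≉0
  ... | no x≉0′ = proj₂ (invertible x x≉0′)

  ⁻¹-nonNegative : ∀ x → 0# ≤ x → 0# ≤ x ⁻¹
  ⁻¹-nonNegative x 0≤x with x ≤.≟ 0#
  ... | yes _  = ≤.refl
  ... | no x≉0 with invertible x x≉0
  ...   | y , xy≈1 with ≤.total 0# y
  ...     | inj₁ 0≤y = 0≤y
  ...     | inj₂ y≤0 = contradiction
    (0≤y-x⇒x≤y (≤.trans (*-nonNegative 0≤x (x≤0⇒0≤-x y≤0)) (≤.reflexive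
      (trans (sym (R.-‿distribʳ-* x y)) (trans (-‿cong xy≈1) (sym (+-identityˡ (- 1#))))))))
    1≰0

  ½ : Carrier
  ½ = 2# ⁻¹

  infimum : (P : Pred Carrier r) → ∃ P → ∃ (LowerBound P) → ∃ (IsInfimum P)
  infimum P (x , Px) (b , b≤P)
    with supremum (LowerBound P) (b , b≤P) (x , λ y y≤P → y≤P x Px)
  ... | i , ub , least = i , (λ y Py → least y (λ z z≤P → z≤P y Py)) , ub

  Below√ : Carrier → Pred Carrier r
  Below√ x y = ∃ λ z → y ≈ z × z * z ≤ x

  0∈Below√ : ∀ {x} → 0# ≤ x → Below√ x 0#
  0∈Below√ 0≤x = 0# , refl , ≤.trans (≤.reflexive (zeroˡ 0#)) 0≤x

  Below√-bounded : ∀ {x} → 0# ≤ x → UpperBound (Below√ x) (1# + x)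
  Below√-bounded {x} 0≤x y (z , y≈z , zz≤x) = ≤.trans (≤.reflexive y≈z) bound
    where
    bound : z ≤ 1# + x
    bound with ≤.total z 1#
    ... | inj₁ z≤1 = ≤.trans z≤1 (x≤x+y 1# 0≤x)
    ... | inj₂ 1≤z = ≤.trans (≤.trans z≤zz zz≤x) (x≤y+x x 0≤1)
      where
      z≤zz : z ≤ z * z
      z≤zz = 0≤y-x⇒x≤y (≤.trans
        (*-nonNegative (≤.trans 0≤1 1≤z) (x≤y⇒0≤y-x 1≤z))
        (≤.reflexive (trans (R.x[y-z]≈xy-xz z z 1#) (+-congˡ (-‿cong (*-identityʳ z))))))

  -- √ x is the supremum of { z | z² ≤ x }, with the junk value 0 for x < 0.
  √_ : Carrier → Carrier
  √ x with ≤.total 0# x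
  ... | inj₁ 0≤x = proj₁ (supremum (Below√ x) (0# , 0∈Below√ 0≤x) (1# + x , Below√-bounded 0≤x))
  ... | inj₂ _   = 0#

  √-nonNegative : ∀ x → 0# ≤ √ x
  √-nonNegative x with ≤.total 0# x
  ... | inj₂ _   = ≤.refl
  ... | inj₁ 0≤x with supremum (Below√ x) (0# , 0∈Below√ 0≤x) (1# + x , Below√-bounded 0≤x)
  ...   | s , ub , _ = ub 0# (0∈Below√ 0≤x)

  -- liminf_{n → ∞} aₙ as the supremum over n of the infima of the tails.
  IsLiminf : (ℕ → Carrier) → Carrier → Set r
  IsLiminf a = IsSupremum λ x → ∃ λ n → IsInfimum (λ y → ∃ λ k → n ≤ℕ k × y ≈ a k) x

  -- The limit at 0 of a function on the interval (0,1); the values of f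
  -- outside that interval are irrelevant.
  Limit₀ : (Carrier → Carrier) → Carrier → Set r
  Limit₀ f l = ∀ ε → 0# < ε → ∃ λ δ → 0# < δ ×
    (∀ s → 0# < s → s < 1# → s < δ → (l - ε < f s) × (f s < l + ε))

  ∑⊆ : ∀ {n} → (Subset n → Carrier) → Carrier
  ∑⊆ {zero}  f = f []
  ∑⊆ {suc n} f = ∑⊆ (λ S → f (inside ∷ S)) + ∑⊆ (λ S → f (outside ∷ S))

  ∑⊆-cong : ∀ {n} {f g : Subset n → Carrier} → (∀ S → f S ≈ g S) → ∑⊆ f ≈ ∑⊆ g
  ∑⊆-cong {zero}  f≈g = f≈g []
  ∑⊆-cong {suc n} f≈g = +-cong (∑⊆-cong λ S → f≈g (inside ∷ S)) (∑⊆-cong λ S → f≈g (outside ∷ S))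

  ∑⊆-distribˡ : ∀ {n} x (f : Subset n → Carrier) → ∑⊆ (λ S → x * f S) ≈ x * ∑⊆ f
  ∑⊆-distribˡ {zero}  x f = refl
  ∑⊆-distribˡ {suc n} x f = trans
    (+-cong (∑⊆-distribˡ x λ S → f (inside ∷ S)) (∑⊆-distribˡ x λ S → f (outside ∷ S)))
    (sym (distribˡ x _ _))

  ∑⊆-nonNegative : ∀ {n} {f : Subset n → Carrier} → (∀ S → 0# ≤ f S) → 0# ≤ ∑⊆ f
  ∑⊆-nonNegative {zero}  0≤f = 0≤f []
  ∑⊆-nonNegative {suc n} 0≤f =
    +-nonNegative (∑⊆-nonNegative λ S → 0≤f (inside ∷ S)) (∑⊆-nonNegative λ S → 0≤f (outside ∷ S))

  term≤∑⊆ : ∀ {n} {f : Subset n → Carrier} → (∀ S → 0# ≤ f S) → ∀ S → f S ≤ ∑⊆ f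
  term≤∑⊆ 0≤f [] = ≤.refl
  term≤∑⊆ 0≤f (true ∷ S) = ≤.trans (term≤∑⊆ (λ S → 0≤f (inside ∷ S)) S)
    (x≤x+y _ (∑⊆-nonNegative λ S → 0≤f (outside ∷ S)))
  term≤∑⊆ 0≤f (false ∷ S) = ≤.trans (term≤∑⊆ (λ S → 0≤f (outside ∷ S)) S)
    (x≤y+x _ (∑⊆-nonNegative λ S → 0≤f (inside ∷ S)))

  -- Probability measures on {0,1}ⁿ, given by their mass functions.
  record ProbMeasure (n : ℕ) : Set r where
    field
      mass        : Subset n → Carrier
      nonNegative : ∀ S → 0# ≤ mass S
      total       : ∑⊆ mass ≈ 1#

  open ProbMeasure public

  record Coupling {n} (μ ν : ProbMeasure n) : Set r where
    field
      joint            : Subset n → Subset n → Carrier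
      jointNonNegative : ∀ S T → 0# ≤ joint S T
      marginalˡ        : ∀ S → ∑⊆ (λ T → joint S T) ≈ mass μ S
      marginalʳ        : ∀ T → ∑⊆ (λ S → joint S T) ≈ mass ν T

  open Coupling public

  independentCoupling : ∀ {n} (μ ν : ProbMeasure n) → Coupling μ ν
  independentCoupling μ ν = record
    { joint            = λ S T → mass μ S * mass ν T
    ; jointNonNegative = λ S T → *-nonNegative (nonNegative μ S) (nonNegative ν T)
    ; marginalˡ        = λ S → trans (∑⊆-distribˡ (mass μ S) (mass ν))
                           (trans (*-congˡ (total ν)) (*-identityʳ (mass μ S)))
    ; marginalʳ        = λ T → trans (∑⊆-cong λ S → *-comm (mass μ S) (mass ν T))
                           (trans (∑⊆-distribˡ (mass ν T) (mass μ))
                             (trans (*-congˡ (total μ)) (*-identityʳ (mass ν T))))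
    }

  ‖_‖² : ∀ {n} → Vector Carrier n → Carrier
  ‖ x ‖² = sum λ i → (x i) ²

  indicator : ∀ {n} → Subset n → Vector Carrier n
  indicator S i = if lookup S i then 1# else 0#

  secondMoment : ∀ {n} → ProbMeasure n → Carrier
  secondMoment μ = ∑⊆ λ S → mass μ S * ‖ indicator S ‖²

  normalized : ∀ {n} → ProbMeasure n → Subset n → Vector Carrier n
  normalized μ S i = indicator S i * (√ (secondMoment μ)) ⁻¹

  transportCost : ∀ {n} {μ ν : ProbMeasure n} → Coupling μ ν → Carrier
  transportCost {n} {μ} {ν} π =
    √ ∑⊆ λ S → ∑⊆ λ T → joint π S T * ‖ (λ i → normalized μ S i - normalized ν T i) ‖²

  w₂ : ∀ {n} → ProbMeasure n → ProbMeasure n → Carrier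
  w₂ μ ν = proj₁ (infimum
    (λ x → ∃ λ (π : Coupling μ ν) → x ≈ transportCost π)
    (_ , independentCoupling μ ν , refl)
    (0# , λ x (π , x≈cost) → ≤.trans (√-nonNegative _) (≤.reflexive (sym x≈cost))))

  𝟙-independent : ∀ {n} → Graph n → Subset n → Carrier
  𝟙-independent G S = if does (independent? G S) then 1# else 0#

  #independent : ∀ {n} → Graph n → Carrier
  #independent G = ∑⊆ (𝟙-independent G)

  0≤𝟙 : ∀ {n} (G : Graph n) S → 0# ≤ 𝟙-independent G S
  0≤𝟙 G S with does (independent? G S)
  ... | true  = 0≤1
  ... | false = ≤.refl

  1≤#independent : ∀ {n} (G : Graph n) → 1# ≤ #independent G
  1≤#independent G = ≤.trans
    (≤.reflexive (reflexive (≡.cong (if_then 1# else 0#)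
      (≡.sym (dec-true (independent? G ⊥) (∅-independent G))))))
    (term≤∑⊆ (0≤𝟙 G) ⊥)

  #independent≉0 : ∀ {n} (G : Graph n) → #independent G ≉ 0#
  #independent≉0 G #≈0 = 1≰0 (≤.trans (1≤#independent G) (≤.reflexive #≈0))

  hardcore : ∀ {n} → Graph n → ProbMeasure n
  hardcore G = record
    { mass        = λ S → (#independent G) ⁻¹ * 𝟙-independent G S
    ; nonNegative = λ S → *-nonNegative
        (⁻¹-nonNegative _ (≤.trans 0≤1 (1≤#independent G))) (0≤𝟙 G S)
    ; total       = trans (∑⊆-distribˡ _ (𝟙-independent G))
        (trans (*-comm _ _) (*-⁻¹-inverse _ (#independent≉0 G)))
    }

  -- A law with finite support, given by its expectation functional: for
  -- D : Law A and f : A → Carrier, D f is the expectation of f under D.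
  -- Sampling x from D and continuing with f x is written D λ x → f x.
  Law : Set → Set c
  Law A = (A → Carrier) → Carrier

  bernoulli : Carrier → Law Bool
  bernoulli p f = p * f true + (1# - p) * f false

  randomRow : ∀ n → Law (Subset n)
  randomRow zero    f = f []
  randomRow (suc n) f = bernoulli ½ λ b → randomRow n λ N → f (b ∷ N)

  G[_,½] : ∀ n → Law (Graph n)
  G[ zero  ,½] f = f ∅
  G[ suc n ,½] f = G[ n ,½] λ G → randomRow n λ N → f (G ▷ N)

  resampleEdge : Carrier → Bool → Law Bool
  resampleEdge s b f = bernoulli s λ fresh → if fresh then bernoulli ½ f else f b

  resampleRow : ∀ {n} → Carrier → Subset n → Law (Subset n)
  resampleRow s []      f = f []
  resampleRow s (b ∷ N) f = resampleEdge s b λ b′ → resampleRow s N λ N′ → f (b′ ∷ N′)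

  resample : ∀ {n} → Carrier → Graph n → Law (Graph n)
  resample s ∅       f = f ∅
  resample s (G ▷ N) f = resample s G λ G′ → resampleRow s N λ N′ → f (G′ ▷ N′)

{-# OPTIONS --safe #-}

-- If S is an independent set of 𝐆, S ∩ T ⊆ S is independent in 𝐆′ for every
-- T in the support of μ_𝐆′.  Given 𝐆, the graph 𝐆′[S] is a binomial random
-- graph of edge density s/2, whose independent sets have size o(|S|) on
-- average.  So every coupling makes the overlap |S ∩ T| negligible against
-- the second moments E|S| and E|T|, once these are large, and w₂² is close to
-- 2 for each fixed s.
--
-- Quantitatively, with κ = 1 - η and 2 κᴷ ≥ 1, each W ⊆ S independent in 𝐆′
-- has η K |W| ≤ η |S| + κ^|S| 2^|W|, and 2^|W| is at most the number of
-- independent subsets of S in 𝐆′, whose κ^|S|-damped mean is bounded.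
--
-- E|S| is at least half the smallest size of a maximal independent set, because
-- deleting or inserting a vertex v pairs up the independent sets S to which v
-- has no neighbour; and bounded dominating sets become unlikely as n grows.

module Submission where

open import Defs
import Algebra.Properties.CommutativeSemiring.Exp
import Algebra.Properties.Ring
import Algebra.Properties.Semiring.Exp
import Algebra.Properties.Semiring.Mult
import Algebra.Properties.Semiring.Mult.TCOptimised
import Algebra.Solver.Ring
open import Algebra.Solver.Ring.AlmostCommutativeRing
  using (fromCommutativeRing; _-Raw-AlmostCommutative⟶_)
open import Data.Bool.Base using (Bool; true; false; if_then_else_; T; not; _∧_)
import Data.Bool.Properties as Bool
open import Data.Fin.Base using (Fin; zero; suc)
import Data.Fin.Properties as Fin
open import Data.Fin.Subset using (Subset; inside; outside; _∈_; _∉_; _⊆_; _∩_; ∣_∣)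
open import Data.Fin.Subset.Properties
  using (_∈?_; nonempty?; p∩q⊆p; p∩q⊆q; ∩-comm; ⊆-refl; ⊆-trans; p⊂q⇒∣p∣<∣q∣;
         x∈p⇒∣p-x∣<∣p∣)
open import Data.Integer.Base as ℤ using (ℤ; -[1+_])
import Data.Integer.Properties as ℤ
open import Data.Maybe.Base using (Maybe; just; nothing)
open import Data.Nat.Base as ℕ using (ℕ; zero; suc)
import Data.Nat.Properties as ℕ
open import Data.Product.Base using (∃; _×_; _,_; proj₁; proj₂)
open import Data.Sum.Base using (_⊎_; inj₁; inj₂)
open import Data.Vec.Base using ([]; _∷_; lookup; here; there; updateAt; _[_]≔_)
open import Data.Vec.Properties
  using (lookup⇒[]=; []=⇒lookup; lookup∘updateAt; lookup∘updateAt′; updateAt-minimal;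
         lookup-zipWith; []≔-minimal; []≔-updates)
open import Function.Base using (_∘_)
open import Level using (_⊔_; Lift; lift) renaming (suc to lsuc; zero to 0ℓ)
open import Relation.Binary.Bundles using (DecTotalOrder)
open import Relation.Binary.PropositionalEquality.Core as ≡ using (_≡_)
import Relation.Binary.Reasoning.PartialOrder
open import Relation.Binary.Structures using (IsDecTotalOrder)
open import Relation.Nullary.Decidable using (Dec; yes; no; does; _→-dec_)
open import Relation.Nullary.Negation using (¬_; contradiction)

-- The coupling may be chosen with both graphs in view, so the overlap must be bounded for all `T`
-- at once by a quantity of `S` and the second graph alone. The number of independent subsets of `S`
-- is such a quantity, and it can be averaged exactly: as the vertices of `S` are added one at a
-- time, the mean independence polynomial at weight x changes from E(x) to E(x) + x E(q x), where q
-- = 1 - s/2 is the chance that a non-edge survives. This is unbounded as |S| grows, whence the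
-- damping by κ: for x ≤ η it absorbs the factor 1 + x, and finitely many steps lead from x = q^t
-- back up to x = 1.
--
-- No concentration of the second moments is needed. Splitting the cross term as 2AB ≤ A² + B² pairs
-- each summand with the normalisation of one graph, and reversibility of the resampling gives the
-- two error terms the same mean.
--
-- Dominating sets are counted by a first moment with a weight c: a vertex put into the set leaves
-- each other vertex undominated with probability 1/2, which on average replaces c by c/2.

module RingSolver {c ℓ₁ ℓ₂} (ℝ : CompleteOrderedField c ℓ₁ ℓ₂) where

  open CompleteOrderedField ℝ
  open Algebra.Properties.Ring ring
  open Algebra.Properties.Semiring.Mult.TCOptimised semiring
    using (×-homo-+; ×1-homo-*; 1+×) renaming (_×_ to _·_)

  private
    -- Equality in the abstract field is decidable by axiom but does not compute, so normal forms
    -- take integer coefficients. With the optimised multiple the images of 1 and 2 are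
    -- definitionally `1#` and `2#`.
    ⟦_⟧ : ℤ → Carrier
    ⟦ ℤ.+ n    ⟧ = n · 1#
    ⟦ -[1+ n ] ⟧ = - (suc n · 1#)

    cancel-1 : ∀ x y → (1# + x) - (1# + y) ≈ x - y
    cancel-1 x y = trans (+-congˡ (sym (-‿+-comm 1# y)))
      (trans (+-congʳ (+-comm 1# x)) (trans (+-assoc x 1# (- 1# - y))
        (+-congˡ (trans (sym (+-assoc 1# (- 1#) (- y)))
          (trans (+-congʳ (-‿inverseʳ 1#)) (+-identityˡ (- y)))))))

    ⊖-homo : ∀ m n → ⟦ m ℤ.⊖ n ⟧ ≈ m · 1# - n · 1#
    ⊖-homo m zero = sym (trans (+-congˡ -0#≈0#) (+-identityʳ _))
    ⊖-homo zero (suc n) = sym (+-identityˡ _)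
    ⊖-homo (suc m) (suc n) = trans (reflexive (≡.cong ⟦_⟧ (ℤ.[1+m]⊖[1+n]≡m⊖n m n)))
      (trans (⊖-homo m n) (trans (sym (cancel-1 _ _))
        (sym (+-cong (1+× m 1#) (-‿cong (1+× n 1#))))))

    +-homo : ∀ i j → ⟦ i ℤ.+ j ⟧ ≈ ⟦ i ⟧ + ⟦ j ⟧
    +-homo (ℤ.+ m) (ℤ.+ n) = ×-homo-+ 1# m n
    +-homo (ℤ.+ m) -[1+ n ] = ⊖-homo m (suc n)
    +-homo -[1+ m ] (ℤ.+ n) = trans (⊖-homo n (suc m)) (+-comm _ _)
    +-homo -[1+ m ] -[1+ n ] = trans
      (-‿cong (trans (reflexive (≡.cong (λ k → suc k · 1#) (≡.sym (ℕ.+-suc m n))))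
        (×-homo-+ 1# (suc m) (suc n))))
      (sym (-‿+-comm _ _))

    -‿homo : ∀ i → ⟦ ℤ.- i ⟧ ≈ - ⟦ i ⟧
    -‿homo (ℤ.+ zero) = sym -0#≈0#
    -‿homo (ℤ.+ suc n) = refl
    -‿homo -[1+ n ] = sym (-‿involutive _)

    +*-homo : ∀ m j → ⟦ ℤ.+ m ℤ.* j ⟧ ≈ m · 1# * ⟦ j ⟧
    +*-homo m (ℤ.+ n) =
      trans (reflexive (≡.cong ⟦_⟧ (≡.sym (ℤ.pos-* m n)))) (×1-homo-* m n)
    +*-homo m -[1+ n ] = trans
      (reflexive (≡.cong ⟦_⟧ (≡.sym (ℤ.neg-distribʳ-* (ℤ.+ m) (ℤ.+ suc n)))))
      (trans (-‿homo (ℤ.+ m ℤ.* ℤ.+ suc n))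
        (trans (-‿cong (+*-homo m (ℤ.+ suc n))) (-‿distribʳ-* _ _)))

    *-homo : ∀ i j → ⟦ i ℤ.* j ⟧ ≈ ⟦ i ⟧ * ⟦ j ⟧
    *-homo (ℤ.+ m) j = +*-homo m j
    *-homo -[1+ m ] j = trans
      (reflexive (≡.cong ⟦_⟧ (≡.sym (ℤ.neg-distribˡ-* (ℤ.+ suc m) j))))
      (trans (-‿homo (ℤ.+ suc m ℤ.* j))
        (trans (-‿cong (+*-homo (suc m) j)) (-‿distribˡ-* _ _)))

    homomorphism : ℤ.+-*-rawRing -Raw-AlmostCommutative⟶ fromCommutativeRing commutativeRing
    homomorphism = record
      { ⟦_⟧ = ⟦_⟧ ; +-homo = +-homo ; *-homo = *-homo
      ; -‿homo = -‿homo ; 0-homo = refl ; 1-homo = refl }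

    dec : ∀ i j → Maybe (⟦ i ⟧ ≈ ⟦ j ⟧)
    dec i j with i ℤ.≟ j
    ... | yes i≡j = just (reflexive (≡.cong ⟦_⟧ i≡j))
    ... | no _    = nothing

  open Algebra.Solver.Ring _ _ homomorphism dec public
    using (solve; con; _:=_; _:+_; _:*_; _:-_; :-_; Polynomial)

  :0 :1 :2 : ∀ {n} → Polynomial n
  :0 = con (ℤ.+ 0)
  :1 = con (ℤ.+ 1)
  :2 = con (ℤ.+ 2)

-- Ordered-field arithmetic.

module OrderedField {c ℓ₁ ℓ₂} (ℝ : CompleteOrderedField c ℓ₁ ℓ₂) where

  open Real ℝ hiding (zero)
  open RingSolver ℝ
  module ≤ = IsDecTotalOrder isDecTotalOrder
  open Algebra.Properties.Semiring.Exp semiring public using (_^_; ^-homo-*; ^-assocʳ)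
  open Algebra.Properties.Semiring.Mult semiring public
    using (×-homo-+; ×1-homo-*) renaming (_×_ to _·_)

  decTotalOrder : DecTotalOrder c ℓ₁ ℓ₂
  decTotalOrder = record { isDecTotalOrder = isDecTotalOrder }

  open Relation.Binary.Reasoning.PartialOrder (DecTotalOrder.poset decTotalOrder)

  ι : ℕ → Carrier
  ι n = n · 1#

  ≤-by : ∀ {x y} e → 0# ≤ e → y ≈ x + e → x ≤ y
  ≤-by {x} e 0≤e y≈x+e = ≤.trans (x≤x+y x 0≤e) (≤.reflexive (sym y≈x+e))

  ≰⇒≥ : ∀ {x y} → ¬ x ≤ y → y ≤ x
  ≰⇒≥ {x} {y} x≰y with ≤.total x y
  ... | inj₁ x≤y = contradiction x≤y x≰y
  ... | inj₂ y≤x = y≤x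

  ≰⇒> : ∀ {x y} → ¬ x ≤ y → y < x
  ≰⇒> x≰y = ≰⇒≥ x≰y , λ y≈x → x≰y (≤.reflexive (sym y≈x))

  +-mono-≤ : ∀ {x y u v} → x ≤ y → u ≤ v → x + u ≤ y + v
  +-mono-≤ {y = y} {u} x≤y u≤v = ≤.trans (+-monoˡ-≤ u x≤y) (+-monoʳ-≤ y u≤v)

  *-monoˡ-≤ : ∀ {x y} z → 0# ≤ z → x ≤ y → z * x ≤ z * y
  *-monoˡ-≤ {x} {y} z 0≤z x≤y = ≤-by (z * (y - x)) (*-nonNegative 0≤z (x≤y⇒0≤y-x x≤y))
    (solve 3 (λ x y z → z :* y := z :* x :+ z :* (y :- x)) refl x y z)

  *-monoʳ-≤ : ∀ {x y} z → 0# ≤ z → x ≤ y → x * z ≤ y * z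
  *-monoʳ-≤ {x} {y} z 0≤z x≤y = begin
    x * z ≈⟨ *-comm x z ⟩
    z * x ≤⟨ *-monoˡ-≤ z 0≤z x≤y ⟩
    z * y ≈⟨ *-comm z y ⟩
    y * z ∎

  *-mono-≤ : ∀ {x y u v} → 0# ≤ y → 0# ≤ u → x ≤ y → u ≤ v → x * u ≤ y * v
  *-mono-≤ 0≤y 0≤u x≤y u≤v = ≤.trans (*-monoʳ-≤ _ 0≤u x≤y) (*-monoˡ-≤ _ 0≤y u≤v)

  *-cancelˡ-≤ : ∀ {x y} z → 0# < z → z * x ≤ z * y → x ≤ y
  *-cancelˡ-≤ {x} {y} z (0≤z , 0≉z) zx≤zy = begin
    x                ≈⟨ lemma x ⟩
    z ⁻¹ * (z * x)   ≤⟨ *-monoˡ-≤ (z ⁻¹) (⁻¹-nonNegative z 0≤z) zx≤zy ⟩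
    z ⁻¹ * (z * y)   ≈⟨ lemma y ⟨
    y                ∎
    where
    lemma : ∀ x → x ≈ z ⁻¹ * (z * x)
    lemma x = trans (sym (*-identityˡ x))
      (trans (*-congʳ (sym (*-⁻¹-inverse z λ z≈0 → 0≉z (sym z≈0))))
        (solve 3 (λ x z i → z :* i :* x := i :* (z :* x)) refl x z (z ⁻¹)))

  0<1 : 0# < 1#
  0<1 = 0≤1 , 0≉1

  <-≤-trans : ∀ {x y z} → x < y → y ≤ z → x < z
  <-≤-trans (x≤y , x≉y) y≤z = ≤.trans x≤y y≤z ,
    λ x≈z → x≉y (≤.antisym x≤y (≤.trans y≤z (≤.reflexive (sym x≈z))))

  <⇒≱ : ∀ {x y} → x < y → ¬ y ≤ x
  <⇒≱ (x≤y , x≉y) y≤x = x≉y (≤.antisym x≤y y≤x)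

  0<2 : 0# < 2#
  0<2 = <-≤-trans 0<1 (x≤x+y 1# 0≤1)

  *-pos : ∀ {x y} → 0# < x → 0# < y → 0# < x * y
  *-pos {x} {y} 0<x@(0≤x , _) 0<y@(0≤y , 0≉y) = *-nonNegative 0≤x 0≤y ,
    λ 0≈xy → <⇒≱ 0<y (*-cancelˡ-≤ x 0<x (≤.reflexive (trans (sym 0≈xy) (sym (zeroʳ x)))))

  ⁻¹-pos : ∀ {x} → 0# < x → 0# < x ⁻¹
  ⁻¹-pos {x} (0≤x , 0≉x) = ⁻¹-nonNegative x 0≤x , λ 0≈x⁻¹ → 0≉1
    (trans (trans (sym (zeroʳ x)) (*-congˡ 0≈x⁻¹)) (*-⁻¹-inverse x λ x≈0 → 0≉x (sym x≈0)))

  0<½ : 0# < ½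
  0<½ = ⁻¹-pos 0<2

  2*½≈1 : 2# * ½ ≈ 1#
  2*½≈1 = *-⁻¹-inverse 2# λ 2≈0 → proj₂ 0<2 (sym 2≈0)

  ½≤1 : ½ ≤ 1#
  ½≤1 = ≤-by ½ (proj₁ 0<½) (trans (sym 2*½≈1) (solve 1 (λ h → :2 :* h := h :+ h) refl ½))

  1-½≈½ : 1# - ½ ≈ ½
  1-½≈½ = trans (+-congʳ (sym 2*½≈1)) (solve 1 (λ h → :2 :* h :- h := h) refl ½)

  halves : ∀ x → ½ * x + ½ * x ≈ x
  halves x = trans (solve 2 (λ h x → h :* x :+ h :* x := (:2 :* h) :* x) refl ½ x)
    (trans (*-congʳ 2*½≈1) (*-identityˡ x))

  ^-nonNegative : ∀ {x} n → 0# ≤ x → 0# ≤ x ^ n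
  ^-nonNegative zero    0≤x = 0≤1
  ^-nonNegative (suc n) 0≤x = *-nonNegative 0≤x (^-nonNegative n 0≤x)

  ^-pos : ∀ {x} n → 0# < x → 0# < x ^ n
  ^-pos zero    0<x = 0<1
  ^-pos (suc n) 0<x = *-pos 0<x (^-pos n 0<x)

  1≤^ : ∀ {x} n → 1# ≤ x → 1# ≤ x ^ n
  1≤^ zero    1≤x = ≤.refl
  1≤^ {x} (suc n) 1≤x = begin
    1#        ≈⟨ *-identityˡ 1# ⟨
    1# * 1#   ≤⟨ *-mono-≤ (≤.trans 0≤1 1≤x) 0≤1 1≤x (1≤^ n 1≤x) ⟩
    x ^ suc n ∎

  *-≤1 : ∀ {x y} → 0# ≤ y → x ≤ 1# → y ≤ 1# → x * y ≤ 1#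
  *-≤1 {x} {y} 0≤y x≤1 y≤1 = begin
    x * y   ≤⟨ *-mono-≤ 0≤1 0≤y x≤1 y≤1 ⟩
    1# * 1# ≈⟨ *-identityˡ 1# ⟩
    1#      ∎

  ^-≤1 : ∀ {x} n → 0# ≤ x → x ≤ 1# → x ^ n ≤ 1#
  ^-≤1 zero    0≤x x≤1 = ≤.refl
  ^-≤1 (suc n) 0≤x x≤1 = *-≤1 (^-nonNegative n 0≤x) x≤1 (^-≤1 n 0≤x x≤1)

  ι-nonNegative : ∀ n → 0# ≤ ι n
  ι-nonNegative zero    = ≤.refl
  ι-nonNegative (suc n) = +-nonNegative 0≤1 (ι-nonNegative n)

  ι-mono-≤ : ∀ {m n} → m ℕ.≤ n → ι m ≤ ι n
  ι-mono-≤ {n = n} ℕ.z≤n = ι-nonNegative n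
  ι-mono-≤ (ℕ.s≤s m≤n)   = +-monoʳ-≤ 1# (ι-mono-≤ m≤n)

  ι-pos : ∀ n → 0# < ι (suc n)
  ι-pos n = <-≤-trans 0<1 (x≤x+y 1# (ι-nonNegative n))

  bernoulli-≤ : ∀ {x} n → 0# ≤ x → x ≤ 1# → 1# - ι n * x ≤ (1# - x) ^ n
  bernoulli-≤ {x} zero 0≤x x≤1 =
    ≤.reflexive (solve 1 (λ x → :1 :- :0 :* x := :1) refl x)
  bernoulli-≤ {x} (suc n) 0≤x x≤1 = begin
    1# - (1# + ι n) * x         ≤⟨ ≤-by (ι n * (x * x)) (*-nonNegative (ι-nonNegative n) (0≤x² x))
      (solve 2 (λ k x → (:1 :- x) :* (:1 :- k :* x) := (:1 :- (:1 :+ k) :* x) :+ k :* (x :* x))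
        refl (ι n) x) ⟩
    (1# - x) * (1# - ι n * x)   ≤⟨ *-monoˡ-≤ (1# - x) (x≤y⇒0≤y-x x≤1) (bernoulli-≤ n 0≤x x≤1) ⟩
    (1# - x) * (1# - x) ^ n     ∎

  -- The slightly larger quantity `(1# - x) ^ n * (ι n * x + 1#)` equals 1 at `n = 0` and does not
  -- increase with `n`. This gives geometric decay without logarithms.
  ^-decay : ∀ {x} n → 0# ≤ x → x ≤ 1# → (1# - x) ^ n * (ι n * x) ≤ 1#
  ^-decay {x} n 0≤x x≤1 = ≤.trans (≤-by ((1# - x) ^ n) (^-nonNegative n 0≤1-x)
      (solve 2 (λ p k → p :* (k :+ :1) := p :* k :+ p) refl ((1# - x) ^ n) (ι n * x)))
      (lemma n)
    where
    0≤1-x = x≤y⇒0≤y-x x≤1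
    lemma : ∀ n → (1# - x) ^ n * (ι n * x + 1#) ≤ 1#
    lemma zero = ≤.reflexive (solve 1 (λ x → :1 :* (:0 :* x :+ :1) := :1) refl x)
    lemma (suc n) = ≤.trans
      (≤-by ((1# - x) ^ n * ((1# + ι n) * (x * x)))
        (*-nonNegative (^-nonNegative n 0≤1-x) (*-nonNegative (ι-nonNegative (suc n)) (0≤x² x)))
        (solve 3 (λ p k x → p :* (k :* x :+ :1)
            := (:1 :- x) :* p :* ((:1 :+ k) :* x :+ :1) :+ p :* ((:1 :+ k) :* (x :* x)))
          refl ((1# - x) ^ n) (ι n) x))
      (lemma n)

  -- The witness stays under a double negation: the supremum axiom only
  -- refutes that all ι n lie below x.
  archimedean : ∀ x → ¬ ¬ (∃ λ n → x ≤ ι n)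
  archimedean x unbounded with supremum (λ y → Lift (c ⊔ ℓ₂) (∃ λ n → y ≈ ι n)) (0# , lift (0 , refl))
    (x , λ { y (lift (n , y≈ιn)) → ≤.trans (≤.reflexive y≈ιn) (≰⇒≥ λ x≤ιn → unbounded (n , x≤ιn)) })
  ... | s , ub , least = 1≰0 (begin
    1#              ≤⟨ ≤-by (s - 1# - s) (x≤y⇒0≤y-x s≤s-1)
                         (solve 1 (λ s → :0 := :1 :+ (s :- :1 :- s)) refl s) ⟩
    0#              ∎)
    where
    s≤s-1 : s ≤ s - 1#
    s≤s-1 = least (s - 1#) λ { y (lift (n , y≈ιn)) → begin
      y              ≈⟨ y≈ιn ⟩
      ι n            ≈⟨ solve 1 (λ k → k := (:1 :+ k) :- :1) refl (ι n) ⟩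
      ι (suc n) - 1# ≤⟨ +-monoˡ-≤ (- 1#) (ub _ (lift (suc n , refl))) ⟩
      s - 1#         ∎ }

  -- Null sequences under double negation.

  infixl 1 _>>=_
  _>>=_ : ∀ {a b} {A : Set a} {B : Set b} → ¬ ¬ A → (A → ¬ ¬ B) → ¬ ¬ B
  (¬¬a >>= f) ¬b = ¬¬a λ a → f a ¬b

  -- Every threshold stems from `archimedean`, so it stays under a double negation. This costs
  -- nothing in the end: the final use is to prove an inequality of reals, which is decidable and
  -- hence stable.
  Eventually : ∀ {p} → (ℕ → Set p) → Set p
  Eventually P = ¬ ¬ (∃ λ N → ∀ n → N ℕ.≤ n → P n)

  Null : (ℕ → Carrier) → Set _
  Null x = ∀ ε → 0# < ε → Eventually λ n → x n ≤ ε

  archimedean-* : ∀ x {ε} → 0# < ε → Eventually λ n → x ≤ ι n * ε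
  archimedean-* x {ε} 0<ε@(0≤ε , 0≉ε) = archimedean (x * ε ⁻¹) >>= λ (N , x/ε≤N) →
    λ k → k (N , λ n N≤n → begin
      x                ≈⟨ *-identityʳ x ⟨
      x * 1#           ≈⟨ *-congˡ (*-⁻¹-inverse ε λ ε≈0 → 0≉ε (sym ε≈0)) ⟨
      x * (ε * ε ⁻¹)   ≈⟨ solve 3 (λ x e i → x :* (e :* i) := x :* i :* e) refl x ε (ε ⁻¹) ⟩
      x * ε ⁻¹ * ε     ≤⟨ *-monoʳ-≤ ε 0≤ε (≤.trans x/ε≤N (ι-mono-≤ N≤n)) ⟩
      ι n * ε          ∎)

  geometric-null : ∀ {h} X → 0# < h → h ≤ 1# → Null λ n → (1# - h) ^ n * X
  geometric-null {h} X 0<h@(0≤h , _) h≤1 ε 0<ε =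
    archimedean-* X (*-pos 0<h 0<ε) >>= λ (N , bound) → λ k → k (N , λ n N≤n → begin
      (1# - h) ^ n * X                 ≤⟨ *-monoˡ-≤ _ (^-nonNegative n (x≤y⇒0≤y-x h≤1)) (bound n N≤n) ⟩
      (1# - h) ^ n * (ι n * (h * ε))   ≈⟨ solve 4 (λ p k h e → p :* (k :* (h :* e)) := e :* (p :* (k :* h)))
                                            refl ((1# - h) ^ n) (ι n) h ε ⟩
      ε * ((1# - h) ^ n * (ι n * h))   ≤⟨ *-monoˡ-≤ ε (proj₁ 0<ε) (^-decay n 0≤h h≤1) ⟩
      ε * 1#                           ≈⟨ *-identityʳ ε ⟩
      ε                                ∎)

  -- Once `y` is at most `h * (½ * ε)`, the recursion is dominated by an affine contraction with
  -- fixed point `½ * ε`, and the contribution of the starting value dies out geometrically.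
  contraction-null : ∀ {h x y} → 0# < h → h ≤ 1# →
    (∀ n → x (suc n) ≤ (1# - h) * x n + y n) → Null y → Null x
  contraction-null {h} {x} {y} 0<h@(0≤h , _) h≤1 step y-null ε 0<ε =
    y-null (h * (½ * ε)) (*-pos 0<h 0<½ε) >>= λ (N , y≤) →
    geometric-null (x N) 0<h h≤1 (½ * ε) 0<½ε >>= λ (M , geo≤) →
    λ k → k (M ℕ.+ N , λ n M+N≤n → begin
      x n                                           ≡⟨ ≡.cong x (≡.sym (ℕ.m∸n+n≡m (ℕ.m+n≤o⇒n≤o M M+N≤n))) ⟩
      x (n ℕ.∸ N ℕ.+ N)                             ≤⟨ iterate N y≤ (n ℕ.∸ N) ⟩
      (1# - h) ^ (n ℕ.∸ N) * x N + ½ * ε            ≤⟨ +-monoˡ-≤ (½ * ε)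
        (geo≤ (n ℕ.∸ N) (ℕ.m+n≤o⇒m≤o∸n M M+N≤n)) ⟩
      ½ * ε + ½ * ε                                 ≈⟨ halves ε ⟩
      ε                                             ∎)
    where
    0<½ε = *-pos 0<½ 0<ε
    iterate : ∀ N → (∀ n → N ℕ.≤ n → y n ≤ h * (½ * ε)) →
      ∀ m → x (m ℕ.+ N) ≤ (1# - h) ^ m * x N + ½ * ε
    iterate N y≤ zero = ≤.trans (≤.reflexive (sym (*-identityˡ (x N)))) (x≤x+y _ (proj₁ 0<½ε))
    iterate N y≤ (suc m) = begin
      x (suc m ℕ.+ N)
        ≤⟨ step (m ℕ.+ N) ⟩
      (1# - h) * x (m ℕ.+ N) + y (m ℕ.+ N)
        ≤⟨ +-mono-≤ (*-monoˡ-≤ _ (x≤y⇒0≤y-x h≤1) (iterate N y≤ m)) (y≤ _ (ℕ.m≤n+m N m)) ⟩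
      (1# - h) * ((1# - h) ^ m * x N + ½ * ε) + h * (½ * ε)
        ≈⟨ solve 4 (λ h p x e → (:1 :- h) :* (p :* x :+ e) :+ h :* e := (:1 :- h) :* p :* x :+ e)
             refl h ((1# - h) ^ m) (x N) (½ * ε) ⟩
      (1# - h) ^ suc m * x N + ½ * ε
        ∎

  -- Square roots.

  ²-cancel-≤ : ∀ {x y} → 0# ≤ y → x ² ≤ y ² → x ≤ y
  ²-cancel-≤ {x} {y} 0≤y x²≤y² with ≤.total x y
  ... | inj₁ x≤y = x≤y
  ... | inj₂ y≤x with (x + y) ≤.≟ 0#
  ...   | yes x+y≈0 = ≤.trans (≤.trans (x≤x+y x 0≤y) (≤.reflexive x+y≈0)) 0≤y
  ...   | no  x+y≉0 = *-cancelˡ-≤ (x + y)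
    (+-nonNegative (≤.trans 0≤y y≤x) 0≤y , λ 0≈x+y → x+y≉0 (sym 0≈x+y))
    (≤-by (y ² - x ²) (x≤y⇒0≤y-x x²≤y²)
      (solve 2 (λ x y → (x :+ y) :* y := (x :+ y) :* x :+ (y :* y :- x :* x)) refl x y))

  ²-mono-≤ : ∀ {x y} → 0# ≤ x → x ≤ y → x ² ≤ y ²
  ²-mono-≤ 0≤x x≤y = *-mono-≤ (≤.trans 0≤x x≤y) 0≤x x≤y x≤y

  private
    module _ {x s} (0≤x : 0# ≤ x) (sup : IsSupremum (Below√ x) s) where
      0≤s : 0# ≤ s
      0≤s = proj₁ sup 0# (0∈Below√ 0≤x)

      s²≤x : s ² ≤ x
      s²≤x with s ² ≤.≤? x
      ... | yes s²≤x = s²≤x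
      ... | no  s²≰x = contradiction s²≤x′ s²≰x
        where
        i = (2# * s) ⁻¹

        -- One Newton step from s: its square is at least x.
        t = (s ² + x) * i

        0<s : 0# < s
        0<s = 0≤s , λ 0≈s → s²≰x (≤.trans (≤.reflexive (trans (*-congʳ (sym 0≈s)) (zeroˡ s))) 0≤x)

        2si≈1 : 2# * s * i ≈ 1#
        2si≈1 = *-⁻¹-inverse _ λ 2s≈0 → proj₂ (*-pos 0<2 0<s) (sym 2s≈0)

        0≤i : 0# ≤ i
        0≤i = ⁻¹-nonNegative _ (*-nonNegative (proj₁ 0<2) 0≤s)

        2st≈ : 2# * s * t ≈ s ² + x
        2st≈ = trans (solve 3 (λ s y i → :2 :* s :* (y :* i) := :2 :* s :* i :* y) refl s (s ² + x) i)
          (trans (*-congʳ 2si≈1) (*-identityˡ _))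

        x≤t² : x ≤ t ²
        x≤t² = ≤-by ((s - t) ²) (0≤x² (s - t)) (trans
          (solve 3 (λ s t x → t :* t := :2 :* s :* t :- s :* s :+ (s :- t) :* (s :- t)) refl s t x)
          (+-congʳ (trans (+-congʳ 2st≈)
            (solve 2 (λ s x → s :* s :+ x :- s :* s := x) refl s x))))

        s≤t : s ≤ t
        s≤t = proj₂ sup t λ { y (z , y≈z , z²≤x) → ≤.trans (≤.reflexive y≈z)
          (²-cancel-≤ (*-nonNegative (+-nonNegative (0≤x² s) 0≤x) 0≤i) (≤.trans z²≤x x≤t²)) }

        s²≤x′ : s ² ≤ x
        s²≤x′ = ≤-by (2# * s * t - 2# * s * s)
          (x≤y⇒0≤y-x (*-monoˡ-≤ (2# * s) (*-nonNegative (proj₁ 0<2) 0≤s) s≤t))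
          (trans (solve 2 (λ s x → x := s :* s :+ (s :* s :+ x :- :2 :* s :* s)) refl s x)
            (+-congˡ (+-congʳ (sym 2st≈))))

      x≤s² : x ≤ s ²
      x≤s² with x ≤.≤? s ²
      ... | yes x≤s² = x≤s²
      ... | no  x≰s² = contradiction (proj₁ sup (s + h) (s + h , refl , [s+h]²≤x))
                         (<⇒≱ (s≤s+h , λ s≈s+h → proj₂ 0<h (0≈h s≈s+h)))
        where
        d = x - s ²
        -- The summand `d` forces `h ≤ 1#`, hence h² ≤ h, and then (s + h)² ≤ s² + (2s + 1) h ≤ s² +
        -- m h = x. So `s + h` lies below the root, against `s` being an upper bound.
        m = s + s + 1# + d
        h = d * m ⁻¹

        s²≤x₁ : s ² ≤ x
        s²≤x₁ = ≰⇒≥ x≰s²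

        0≤d : 0# ≤ d
        0≤d = x≤y⇒0≤y-x s²≤x₁

        0<d : 0# < d
        0<d = 0≤d , λ 0≈d → x≰s² (≤.reflexive (trans
          (solve 2 (λ x y → x := (x :- y) :+ y) refl x (s ²))
          (trans (+-congʳ (sym 0≈d)) (+-identityˡ (s ²)))))

        0≤m : 0# ≤ m
        0≤m = +-nonNegative (+-nonNegative (+-nonNegative 0≤s 0≤s) 0≤1) 0≤d

        0<m : 0# < m
        0<m = <-≤-trans 0<1 (≤-by (s + s + d) (+-nonNegative (+-nonNegative 0≤s 0≤s) 0≤d)
          (solve 2 (λ s d → s :+ s :+ :1 :+ d := :1 :+ (s :+ s :+ d)) refl s d))

        0<h : 0# < h
        0<h = *-pos 0<d (⁻¹-pos 0<m)

        s≤s+h : s ≤ s + h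
        s≤s+h = x≤x+y s (proj₁ 0<h)

        0≈h : s ≈ s + h → 0# ≈ h
        0≈h s≈s+h = trans (sym (-‿inverseʳ s)) (trans (+-congʳ s≈s+h)
          (solve 2 (λ s h → s :+ h :- s := h) refl s h))

        mh≈d : m * h ≈ d
        mh≈d = trans (solve 3 (λ m d i → m :* (d :* i) := m :* i :* d) refl m d (m ⁻¹))
          (trans (*-congʳ (*-⁻¹-inverse m λ m≈0 → proj₂ 0<m (sym m≈0))) (*-identityˡ d))

        h≤1 : h ≤ 1#
        h≤1 = *-cancelˡ-≤ m 0<m (≤-by (s + s + 1#) (+-nonNegative (+-nonNegative 0≤s 0≤s) 0≤1)
          (trans (solve 2 (λ s d → (s :+ s :+ :1 :+ d) :* :1 := d :+ (s :+ s :+ :1)) refl s d)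
            (+-congʳ (sym mh≈d))))

        [s+h]²≤x : (s + h) * (s + h) ≤ x
        [s+h]²≤x = ≤-by (h * (1# - h) + d * h)
          (+-nonNegative (*-nonNegative (proj₁ 0<h) (x≤y⇒0≤y-x h≤1)) (*-nonNegative 0≤d (proj₁ 0<h)))
          (trans (solve 2 (λ s x → x := s :* s :+ (x :- s :* s)) refl s x)
            (trans (+-congˡ (sym mh≈d))
              (solve 3 (λ s h d → s :* s :+ (s :+ s :+ :1 :+ d) :* h
                := (s :+ h) :* (s :+ h) :+ (h :* (:1 :- h) :+ d :* h)) refl s h d)))

  √-² : ∀ {x} → 0# ≤ x → (√ x) ² ≈ x
  √-² {x} 0≤x with ≤.total 0# x
  ... | inj₂ x≤0 = trans (zeroˡ 0#) (≤.antisym 0≤x x≤0)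
  ... | inj₁ 0≤x′ with supremum (Below√ x) (0# , 0∈Below√ 0≤x′) (1# + x , Below√-bounded 0≤x′)
  ...   | s , sup = ≤.antisym (s²≤x 0≤x′ sup) (x≤s² 0≤x′ sup)

-- Expectation functionals and the resampling law.

module Laws {c ℓ₁ ℓ₂} (ℝ : CompleteOrderedField c ℓ₁ ℓ₂) where

  open Real ℝ hiding (zero)
  open RingSolver ℝ
  open OrderedField ℝ

  record IsLinear {A : Set} (D : Law A) : Set (c ⊔ ℓ₁) where
    field
      cong   : ∀ {f g} → (∀ x → f x ≈ g x) → D f ≈ D g
      +-homo : ∀ f g → D (λ x → f x + g x) ≈ D f + D g
      *-homo : ∀ k f → D (λ x → k * f x) ≈ k * D f

    *-homoʳ : ∀ f k → D (λ x → f x * k) ≈ D f * k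
    *-homoʳ f k = trans (cong λ x → *-comm (f x) k) (trans (*-homo k f) (*-comm k (D f)))

  -- A `Law` hides its finite support, so the interchange of two functionals is carried as a field,
  -- preserved by binding, sums and nonnegative multiples. The partner need only be linear. Total
  -- mass 1 is kept apart in `Total`, so that sums over vertices and over subsets are integrals too.
  record IsIntegral {A : Set} (D : Law A) : Set (lsuc 0ℓ ⊔ c ⊔ ℓ₁ ⊔ ℓ₂) where
    field
      isLinear : IsLinear D
      mono     : ∀ {f g} → (∀ x → f x ≤ g x) → D f ≤ D g
      fubini   : ∀ {B : Set} {E : Law B} → IsLinear E → ∀ (f : A → B → Carrier) →
                 D (λ x → E λ y → f x y) ≈ E λ y → D λ x → f x y
    open IsLinear isLinear public

    nonneg : ∀ {f} → (∀ x → 0# ≤ f x) → 0# ≤ D f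
    nonneg 0≤f = ≤.trans
      (≤.reflexive (sym (trans (*-homo 0# λ _ → 0#) (zeroˡ _))))
      (mono λ x → ≤.trans (≤.reflexive (zeroˡ 0#)) (0≤f x))

  open IsLinear public using () renaming (cong to linear-cong)
  open IsIntegral public

  Total : {A : Set} → Law A → Set (c ⊔ ℓ₁)
  Total D = ∀ k → D (λ _ → k) ≈ k

  eval-integral : {A : Set} (x : A) → IsIntegral (λ f → f x)
  eval-integral x = record
    { isLinear = record { cong = λ f≈g → f≈g x ; +-homo = λ f g → refl ; *-homo = λ k f → refl }
    ; mono     = λ f≤g → f≤g x
    ; fubini   = λ E f → refl
    }

  bind-integral : {A B : Set} {D : Law A} {E : A → Law B} →
    IsIntegral D → (∀ x → IsIntegral (E x)) → IsIntegral (λ f → D λ x → E x f)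
  bind-integral D E = record
    { isLinear = record
      { cong   = λ f≈g → cong D λ x → cong (E x) f≈g
      ; +-homo = λ f g → trans (cong D λ x → +-homo (E x) f g) (+-homo D _ _)
      ; *-homo = λ k f → trans (cong D λ x → *-homo (E x) k f) (*-homo D k _)
      }
    ; mono   = λ f≤g → mono D λ x → mono (E x) f≤g
    ; fubini = λ F f → trans (cong D λ x → fubini (E x) F f) (fubini D F _)
    }

  image-integral : {A B : Set} {D : Law A} (φ : A → B) → IsIntegral D → IsIntegral (λ f → D (f ∘ φ))
  image-integral φ D = bind-integral D (eval-integral ∘ φ)

  plus-integral : {A : Set} {D E : Law A} →
    IsIntegral D → IsIntegral E → IsIntegral (λ f → D f + E f)
  plus-integral D E = record
    { isLinear = record
      { cong   = λ f≈g → +-cong (cong D f≈g) (cong E f≈g)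
      ; +-homo = λ f g → trans (+-cong (+-homo D f g) (+-homo E f g))
          (solve 4 (λ a b c d → (a :+ b) :+ (c :+ d) := (a :+ c) :+ (b :+ d)) refl _ _ _ _)
      ; *-homo = λ k f → trans (+-cong (*-homo D k f) (*-homo E k f)) (sym (distribˡ k _ _))
      }
    ; mono   = λ f≤g → +-mono-≤ (mono D f≤g) (mono E f≤g)
    ; fubini = λ F f → trans (+-cong (fubini D F f) (fubini E F f)) (sym (IsLinear.+-homo F _ _))
    }

  scale-integral : {A : Set} {D : Law A} {k : Carrier} → 0# ≤ k →
    IsIntegral D → IsIntegral (λ f → k * D f)
  scale-integral {k = k} 0≤k D = record
    { isLinear = record
      { cong   = λ f≈g → *-congˡ (cong D f≈g)
      ; +-homo = λ f g → trans (*-congˡ (+-homo D f g)) (distribˡ k _ _)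
      ; *-homo = λ j f → trans (*-congˡ (*-homo D j f))
          (solve 3 (λ k j x → k :* (j :* x) := j :* (k :* x)) refl k j _)
      }
    ; mono   = λ f≤g → *-monoˡ-≤ k 0≤k (mono D f≤g)
    ; fubini = λ F f → trans (*-congˡ (fubini D F f)) (sym (IsLinear.*-homo F k _))
    }

  sum-integral : ∀ n → IsIntegral (sum {n})
  sum-integral zero    = record
    { isLinear = record
      { cong   = λ _ → refl
      ; +-homo = λ _ _ → sym (+-identityˡ 0#)
      ; *-homo = λ k _ → sym (zeroʳ k)
      }
    ; mono   = λ _ → ≤.refl
    ; fubini = λ F f → sym (trans (linear-cong F λ y → sym (zeroˡ 0#))
                 (trans (IsLinear.*-homo F 0# λ _ → 0#) (zeroˡ _)))
    }
  sum-integral (suc n) = plus-integral (eval-integral zero) (image-integral suc (sum-integral n))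

  ∑⊆-integral : ∀ n → IsIntegral (∑⊆ {n})
  ∑⊆-integral zero    = eval-integral []
  ∑⊆-integral (suc n) = plus-integral
    (image-integral (inside ∷_) (∑⊆-integral n)) (image-integral (outside ∷_) (∑⊆-integral n))

  IsProbability : Carrier → Set ℓ₂
  IsProbability p = 0# ≤ p × p ≤ 1#

  bernoulli-integral : ∀ {p} → IsProbability p → IsIntegral (bernoulli p)
  bernoulli-integral (0≤p , p≤1) = plus-integral
    (scale-integral 0≤p (eval-integral true))
    (scale-integral (x≤y⇒0≤y-x p≤1) (eval-integral false))

  bernoulli-total : ∀ p → Total (bernoulli p)
  bernoulli-total p k = solve 2 (λ p k → p :* k :+ (:1 :- p) :* k := k) refl p k

  ½-probability : IsProbability ½
  ½-probability = proj₁ 0<½ , ½≤1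

  randomRow-integral : ∀ n → IsIntegral (randomRow n)
  randomRow-integral zero    = eval-integral []
  randomRow-integral (suc n) = bind-integral (bernoulli-integral ½-probability) λ b →
    image-integral (b ∷_) (randomRow-integral n)

  randomRow-total : ∀ n → Total (randomRow n)
  randomRow-total zero    k = refl
  randomRow-total (suc n) k = trans
    (cong (bernoulli-integral ½-probability) λ b → randomRow-total n k) (bernoulli-total ½ k)

  G-integral : ∀ n → IsIntegral (G[ n ,½])
  G-integral zero    = eval-integral ∅
  G-integral (suc n) = bind-integral (G-integral n) λ G → image-integral (G ▷_) (randomRow-integral n)

  G-total : ∀ n → Total (G[ n ,½])
  G-total zero    k = refl
  G-total (suc n) k = trans (cong (G-integral n) λ G → randomRow-total n k) (G-total n k)

  -- Detailed balance: a start drawn from `D` and its image under `R` form an exchangeable pair.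
  Reversible : {A : Set} → Law A → (A → Law A) → Set (c ⊔ ℓ₁)
  Reversible {A} D R = ∀ (f : A → A → Carrier) → (D λ x → R x λ y → f x y) ≈ (D λ x → R x λ y → f y x)

  -- Fubini brings each coordinate next to its own move, after which the two balances are applied
  -- one after the other.
  reversible-× : {A B : Set} {D₁ : Law A} {R₁ : A → Law A} {D₂ : Law B} {R₂ : B → Law B} →
    IsIntegral D₁ → (∀ x → IsIntegral (R₁ x)) → IsIntegral D₂ →
    Reversible D₁ R₁ → Reversible D₂ R₂ → ∀ (f : A → B → A → B → Carrier) →
    (D₁ λ x → D₂ λ u → R₁ x λ y → R₂ u λ v → f x u y v) ≈
    (D₁ λ x → D₂ λ u → R₁ x λ y → R₂ u λ v → f y v x u)
  reversible-× D₁ R₁ D₂ rev₁ rev₂ f = trans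
    (cong D₁ λ x → trans (fubini D₂ (isLinear (R₁ x)) _) (cong (R₁ x) λ y → rev₂ λ u v → f x u y v))
    (trans (rev₁ _) (cong D₁ λ x → sym (fubini D₂ (isLinear (R₁ x)) _)))

  module Resample {s} (s-probability : IsProbability s) where

    resampleEdge-integral : ∀ b → IsIntegral (resampleEdge s b)
    resampleEdge-integral b = bind-integral {E = λ fresh f → if fresh then bernoulli ½ f else f b}
      (bernoulli-integral s-probability)
      λ { true → bernoulli-integral ½-probability ; false → eval-integral b }

    resampleRow-integral : ∀ {n} (N : Subset n) → IsIntegral (resampleRow s N)
    resampleRow-integral []      = eval-integral []
    resampleRow-integral (b ∷ N) = bind-integral (resampleEdge-integral b) λ b′ →
      image-integral (b′ ∷_) (resampleRow-integral N)

    resample-integral : ∀ {n} (G : Graph n) → IsIntegral (resample s G)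
    resample-integral ∅       = eval-integral ∅
    resample-integral (G ▷ N) = bind-integral (resample-integral G) λ G′ →
      image-integral (G′ ▷_) (resampleRow-integral N)

    resampleEdge-total : ∀ b → Total (resampleEdge s b)
    resampleEdge-total b k = trans (+-congʳ (*-congˡ (bernoulli-total ½ k))) (bernoulli-total s k)

    resampleRow-total : ∀ {n} (N : Subset n) → Total (resampleRow s N)
    resampleRow-total []      k = refl
    resampleRow-total (b ∷ N) k = trans
      (cong (resampleEdge-integral b) λ b′ → resampleRow-total N k) (resampleEdge-total b k)

    resample-total : ∀ {n} (G : Graph n) → Total (resample s G)
    resample-total ∅       k = refl
    resample-total (G ▷ N) k = trans
      (cong (resample-integral G) λ G′ → resampleRow-total N k) (resample-total G k)

    edge-reversible : Reversible (bernoulli ½) (resampleEdge s)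
    edge-reversible f = solve 6
      (λ h s a b c d →
        h :* (s :* (h :* a :+ (:1 :- h) :* b) :+ (:1 :- s) :* a) :+
        (:1 :- h) :* (s :* (h :* c :+ (:1 :- h) :* d) :+ (:1 :- s) :* d) :=
        h :* (s :* (h :* a :+ (:1 :- h) :* c) :+ (:1 :- s) :* a) :+
        (:1 :- h) :* (s :* (h :* b :+ (:1 :- h) :* d) :+ (:1 :- s) :* d))
      refl ½ s (f true true) (f true false) (f false true) (f false false)

    row-reversible : ∀ n → Reversible (randomRow n) (resampleRow s)
    row-reversible zero    f = refl
    row-reversible (suc n) f = reversible-× {R₂ = resampleRow s}
      (bernoulli-integral ½-probability) resampleEdge-integral (randomRow-integral n)
      edge-reversible (row-reversible n) λ b N b′ N′ → f (b ∷ N) (b′ ∷ N′)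

    graph-reversible : ∀ n → Reversible G[ n ,½] (resample s)
    graph-reversible zero    f = refl
    graph-reversible (suc n) f = reversible-× {R₂ = resampleRow s}
      (G-integral n) resample-integral (randomRow-integral n)
      (graph-reversible n) (row-reversible n) λ G N G′ N′ → f (G ▷ N) (G′ ▷ N′)

  -- The row with independent entries, p v being the chance that v is inside.
  rowLaw : ∀ {n} → (Fin n → Carrier) → Law (Subset n)
  rowLaw {zero}  p f = f []
  rowLaw {suc n} p f = bernoulli (p zero) λ b → rowLaw (p ∘ suc) λ N → f (b ∷ N)

  rowLaw-linear : ∀ {n} (p : Fin n → Carrier) → IsLinear (rowLaw p)
  rowLaw-linear {zero}  p = isLinear (eval-integral [])
  rowLaw-linear {suc n} p = record
    { cong   = λ f≈g → +-cong (*-congˡ (linear-cong row λ N → f≈g _)) (*-congˡ (linear-cong row λ N → f≈g _))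
    ; +-homo = λ f g → trans
        (+-cong (*-congˡ (IsLinear.+-homo row _ _)) (*-congˡ (IsLinear.+-homo row _ _)))
        (solve 5 (λ p a b c d → p :* (a :+ b) :+ (:1 :- p) :* (c :+ d)
          := (p :* a :+ (:1 :- p) :* c) :+ (p :* b :+ (:1 :- p) :* d)) refl (p zero) _ _ _ _)
    ; *-homo = λ k f → trans
        (+-cong (*-congˡ (IsLinear.*-homo row k _)) (*-congˡ (IsLinear.*-homo row k _)))
        (solve 4 (λ p k a b → p :* (k :* a) :+ (:1 :- p) :* (k :* b)
          := k :* (p :* a :+ (:1 :- p) :* b)) refl (p zero) k _ _)
    }
    where row = rowLaw-linear (p ∘ suc)

  randomRow≈rowLaw : ∀ n f → randomRow n f ≈ rowLaw (λ _ → ½) f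
  randomRow≈rowLaw zero    f = refl
  randomRow≈rowLaw (suc n) f =
    +-cong (*-congˡ (randomRow≈rowLaw n _)) (*-congˡ (randomRow≈rowLaw n _))

  resampledPresence : ∀ {n} → Carrier → Subset n → Fin n → Carrier
  resampledPresence s N v = if lookup N v then 1# - ½ * s else ½ * s

  resampleRow≈rowLaw : ∀ {n} s (N : Subset n) f → resampleRow s N f ≈ rowLaw (resampledPresence s N) f
  resampleRow≈rowLaw s []      f = refl
  resampleRow≈rowLaw s (true ∷ N) f = trans
    (+-cong (*-congˡ (+-cong (*-congˡ (resampleRow≈rowLaw s N _))
      (*-cong 1-½≈½ (resampleRow≈rowLaw s N _)))) (*-congˡ (resampleRow≈rowLaw s N _)))
    (trans (+-congʳ (*-congˡ (+-congʳ (*-congʳ (sym 1-½≈½)))))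
      (solve 4 (λ h s x y → s :* ((:1 :- h) :* x :+ h :* y) :+ (:1 :- s) :* x
        := (:1 :- h :* s) :* x :+ (:1 :- (:1 :- h :* s)) :* y) refl ½ s _ _))
  resampleRow≈rowLaw s (false ∷ N) f = trans
    (+-cong (*-congˡ (+-cong (*-congˡ (resampleRow≈rowLaw s N _))
      (*-congˡ (resampleRow≈rowLaw s N _)))) (*-congˡ (resampleRow≈rowLaw s N _)))
    (solve 4 (λ h s x y → s :* (h :* x :+ (:1 :- h) :* y) :+ (:1 :- s) :* y
        := (h :* s) :* x :+ (:1 :- h :* s) :* y) refl ½ s _ _)

  -- Degree at most one in each variable is what lets an expectation over independent entries pass
  -- inside. The expansion also shows that `F` respects pointwise `≈` of its argument, which a bare
  -- function on vectors need not do.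
  MultiAffine : ∀ {n} → ((Fin n → Carrier) → Carrier) → Set (c ⊔ ℓ₁)
  MultiAffine {zero}  F = ∃ λ k → ∀ y → F y ≈ k
  MultiAffine {suc n} F = ∃ λ A → ∃ λ B → MultiAffine A × MultiAffine B ×
    (∀ y → F y ≈ A (y ∘ suc) + y zero * B (y ∘ suc))

  multiAffine-cong : ∀ {n} {F : (Fin n → Carrier) → Carrier} → MultiAffine F →
    ∀ {x y} → (∀ v → x v ≈ y v) → F x ≈ F y
  multiAffine-cong {zero}  (k , F≈k) x≈y = trans (F≈k _) (sym (F≈k _))
  multiAffine-cong {suc n} (A , B , A-affine , B-affine , F≈) x≈y = trans (F≈ _) (trans
    (+-cong (multiAffine-cong A-affine (x≈y ∘ suc))
      (*-cong (x≈y zero) (multiAffine-cong B-affine (x≈y ∘ suc))))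
    (sym (F≈ _)))

  multiAffine-* : ∀ {n} {F : (Fin n → Carrier) → Carrier} k → MultiAffine F → MultiAffine (λ y → k * F y)
  multiAffine-* {zero}  k (j , F≈j) = k * j , λ y → *-congˡ (F≈j y)
  multiAffine-* {suc n} k (A , B , A-affine , B-affine , F≈) =
    _ , _ , multiAffine-* k A-affine , multiAffine-* k B-affine , λ y →
      trans (*-congˡ (F≈ y))
        (solve 4 (λ k a t b → k :* (a :+ t :* b) := k :* a :+ t :* (k :* b)) refl k _ _ _)

  multiAffine-scale : ∀ {n} {F : (Fin n → Carrier) → Carrier} (d : Fin n → Carrier) → MultiAffine F →
    MultiAffine (λ y → F λ v → d v * y v)
  multiAffine-scale {zero}  d (k , F≈k) = k , λ y → F≈k _
  multiAffine-scale {suc n} d (A , B , A-affine , B-affine , F≈) =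
    _ , _ , multiAffine-scale (d ∘ suc) A-affine ,
    multiAffine-* (d zero) (multiAffine-scale (d ∘ suc) B-affine) , λ y →
      trans (F≈ _) (+-congˡ (solve 3 (λ d t b → d :* t :* b := t :* (d :* b)) refl (d zero) (y zero) _))

  mask : ∀ {n} → Subset n → (Fin n → Carrier) → Fin n → Carrier
  mask N y v = (if lookup N v then 0# else 1#) * y v

  -- Each independent entry of the row enters with degree at most one, so the mean of `F` at the
  -- random mask is `F` at the mean mask, and `v` stays unmasked with chance `1# - p v`.
  rowLaw-mask : ∀ {n} {F : (Fin n → Carrier) → Carrier} → MultiAffine F → ∀ p y →
    rowLaw p (λ N → F (mask N y)) ≈ F λ v → (1# - p v) * y v
  rowLaw-mask {zero}  (k , F≈k) p y = trans (F≈k _) (sym (F≈k _))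
  rowLaw-mask {suc n} {F} (A , B , A-affine , B-affine , F≈) p y = trans
    (+-cong (*-congˡ (branch true)) (*-congˡ (branch false)))
    (trans (solve 4 (λ p a t b →
        p :* (a :+ :0 :* t :* b) :+ (:1 :- p) :* (a :+ :1 :* t :* b) := a :+ (:1 :- p) :* t :* b)
      refl (p zero) _ (y zero) _) (sym (F≈ _)))
    where
    row = rowLaw-linear (p ∘ suc)
    branch : ∀ b → rowLaw (p ∘ suc) (λ N → F (mask (b ∷ N) y)) ≈
      A (λ v → (1# - p (suc v)) * y (suc v)) +
      (if b then 0# else 1#) * y zero * B (λ v → (1# - p (suc v)) * y (suc v))
    branch b = trans (linear-cong row λ N → F≈ _) (trans (IsLinear.+-homo row _ _)
      (+-cong (rowLaw-mask A-affine (p ∘ suc) (y ∘ suc))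
        (trans (IsLinear.*-homo row _ _) (*-congˡ (rowLaw-mask B-affine (p ∘ suc) (y ∘ suc))))))

-- Independence polynomials.

independent-tail : ∀ {n} {G : Graph n} {N b S} → Independent (G ▷ N) (b ∷ S) → Independent G S
independent-tail ind u u∈S v v∈S = ind (suc u) (there u∈S) (suc v) (there v∈S)

independent-head : ∀ {n} {G : Graph n} {N S} → Independent (G ▷ N) (inside ∷ S) →
  ∀ v → v ∈ S → lookup N v ≡ false
independent-head {N = N} ind v v∈S with lookup N v in eq
... | false = ≡.refl
... | true  = contradiction (≡.subst T (≡.sym eq) _) (ind zero here (suc v) (there v∈S))

module GraphPolynomials {c ℓ₁ ℓ₂} (ℝ : CompleteOrderedField c ℓ₁ ℓ₂) where

  open Real ℝ hiding (zero)
  open RingSolver ℝ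
  open OrderedField ℝ
  open Laws ℝ
  open Relation.Binary.Reasoning.PartialOrder (DecTotalOrder.poset decTotalOrder)

  private
    variable
      n : ℕ

  mask-nonNegative : ∀ (N : Subset n) {y} → (∀ v → 0# ≤ y v) → ∀ v → 0# ≤ mask N y v
  mask-nonNegative N 0≤y v with lookup N v
  ... | true  = *-nonNegative ≤.refl (0≤y v)
  ... | false = *-nonNegative 0≤1 (0≤y v)

  mask-≤1 : ∀ (N : Subset n) {y} → (∀ v → y v ≤ 1#) → ∀ v → mask N y v ≤ 1#
  mask-≤1 N {y} y≤1 v with lookup N v
  ... | true  = ≤.trans (≤.reflexive (zeroˡ (y v))) 0≤1
  ... | false = ≤.trans (≤.reflexive (*-identityˡ (y v))) (y≤1 v)

  mask-outside : ∀ {N : Subset n} {v} → lookup N v ≡ false → ∀ y → y v ≈ mask N y v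
  mask-outside {v = v} v∉N y rewrite v∉N = sym (*-identityˡ (y v))

  -- The sum of ∏_{v ∈ U} y v over all independent sets U.
  independencePolynomial : Graph n → (Fin n → Carrier) → Carrier
  independencePolynomial ∅       y = 1#
  independencePolynomial (G ▷ N) y = independencePolynomial G (y ∘ suc) +
    y zero * independencePolynomial G (mask N (y ∘ suc))

  private
    z = independencePolynomial

  z-multiAffine : (G : Graph n) → MultiAffine (z G)
  z-multiAffine ∅       = 1# , λ y → refl
  z-multiAffine (G ▷ N) =
    z G , _ , z-multiAffine G , multiAffine-scale _ (z-multiAffine G) , λ y → refl

  z-nonNegative : ∀ (G : Graph n) {y} → (∀ v → 0# ≤ y v) → 0# ≤ z G y
  z-nonNegative ∅       0≤y = 0≤1
  z-nonNegative (G ▷ N) 0≤y = +-nonNegative (z-nonNegative G (0≤y ∘ suc))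
    (*-nonNegative (0≤y zero) (z-nonNegative G (mask-nonNegative N (0≤y ∘ suc))))

  -- Every subset of `W` is independent and has weight at least 1; the remaining terms are
  -- nonnegative.
  2^≤z : ∀ (G : Graph n) W {y} → Independent G W → (∀ v → 0# ≤ y v) → (∀ v → v ∈ W → 1# ≤ y v) →
    2# ^ ∣ W ∣ ≤ z G y
  2^≤z ∅       []            ind 0≤y 1≤y = ≤.refl
  2^≤z (G ▷ N) (outside ∷ W) ind 0≤y 1≤y = ≤.trans
    (2^≤z G W (independent-tail ind) (0≤y ∘ suc) (λ v v∈W → 1≤y (suc v) (there v∈W)))
    (x≤x+y _ (*-nonNegative (0≤y zero) (z-nonNegative G (mask-nonNegative N (0≤y ∘ suc)))))
  2^≤z (G ▷ N) (inside ∷ W) {y} ind 0≤y 1≤y = begin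
    2# * 2# ^ ∣ W ∣                                    ≈⟨ solve 1 (λ p → :2 :* p := p :+ :1 :* p) refl _ ⟩
    2# ^ ∣ W ∣ + 1# * 2# ^ ∣ W ∣                       ≤⟨ +-mono-≤ left
      (*-mono-≤ (0≤y zero) (^-nonNegative ∣ W ∣ (proj₁ 0<2)) (1≤y zero here) right) ⟩
    z G (y ∘ suc) + y zero * z G (mask N (y ∘ suc))    ∎
    where
    left = 2^≤z G W (independent-tail ind) (0≤y ∘ suc) (λ v v∈W → 1≤y (suc v) (there v∈W))
    right = 2^≤z G W (independent-tail ind) (mask-nonNegative N (0≤y ∘ suc)) λ v v∈W →
      ≤.trans (1≤y (suc v) (there v∈W)) (≤.reflexive (mask-outside {N = N} (independent-head ind v v∈W) (y ∘ suc)))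

  -- The mean independence polynomial after resampling.

  module ResampledPolynomial {s} (s-probability : IsProbability s) where
    open Resample s-probability

    q : Carrier
    q = 1# - ½ * s

    weight : Carrier → Subset n → Fin n → Carrier
    weight x S v = x * indicator S v

    Ez : Graph n → Subset n → Carrier → Carrier
    Ez G S x = resample s G λ G′ → z G′ (weight x S)

    Ez-outside : ∀ (G : Graph n) N S x → Ez (G ▷ N) (outside ∷ S) x ≈ Ez G S x
    Ez-outside G N S x = cong (resample-integral G) λ G′ → trans
      (cong (resampleRow-integral N) λ N′ →
        solve 3 (λ x a b → a :+ x :* :0 :* b := a) refl x _ _)
      (resampleRow-total N _)

    -- Independence in the original graph means that the new vertex has no edge into `S`, so after
    -- resampling each such pair is a non-edge with probability `q`. Averaging the mask over the row
    -- therefore turns the weight `x` into `q * x`.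
    Ez-inside : ∀ (G : Graph n) N S x → Independent (G ▷ N) (inside ∷ S) →
      Ez (G ▷ N) (inside ∷ S) x ≈ Ez G S x + x * Ez G S (q * x)
    Ez-inside G N S x ind = trans
      (cong (resample-integral G) λ G′ → trans (+-homo (resampleRow-integral N) _ _)
        (+-cong (resampleRow-total N _) (trans (*-homo (resampleRow-integral N) _ _)
          (*-cong (*-identityʳ x) (row G′)))))
      (trans (+-homo (resample-integral G) _ _) (+-congˡ (*-homo (resample-integral G) x _)))
      where
      masked : ∀ v → (1# - resampledPresence s N v) * weight x S v ≈ weight (q * x) S v
      masked v with lookup S v in v∈S
      ... | true  rewrite independent-head ind v (lookup⇒[]= v S v∈S) = sym (*-assoc q x 1#)
      ... | false = solve 3 (λ a x q → a :* (x :* :0) := q :* x :* :0) refl _ x q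

      row : ∀ G′ → resampleRow s N (λ N′ → z G′ (mask N′ (weight x S))) ≈ z G′ (weight (q * x) S)
      row G′ = trans (resampleRow≈rowLaw s N _)
        (trans (rowLaw-mask (z-multiAffine G′) _ _) (multiAffine-cong (z-multiAffine G′) masked))

    0≤q : 0# ≤ q
    0≤q = x≤y⇒0≤y-x (*-≤1 (proj₁ s-probability) ½≤1 (proj₂ s-probability))

    q≤1 : q ≤ 1#
    q≤1 = ≤-by (½ * s) (*-nonNegative (proj₁ 0<½) (proj₁ s-probability))
      (solve 1 (λ x → :1 := (:1 :- x) :+ x) refl (½ * s))

    module Damped {η} (0<η : 0# < η) (η≤1 : η ≤ 1#) where

      κ : Carrier
      κ = 1# - η

      private
        0≤κ = x≤y⇒0≤y-x η≤1

      -- One constant for all graphs and all independent sets: the number of vertices is quantified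
      -- inside.
      Bounded : Carrier → Carrier → Set ℓ₂
      Bounded x C = ∀ {n} (G : Graph n) S → Independent G S → κ ^ ∣ S ∣ * Ez G S x ≤ C

      bounded-inside : ∀ (G : Graph n) N S x {C D} → 0# ≤ x → Independent (G ▷ N) (inside ∷ S) →
        κ ^ ∣ S ∣ * Ez G S x ≤ C → κ ^ ∣ S ∣ * Ez G S (q * x) ≤ D →
        κ ^ ∣ inside ∷ S ∣ * Ez (G ▷ N) (inside ∷ S) x ≤ κ * (C + x * D)
      bounded-inside G N S x {C} {D} 0≤x ind ≤C ≤D = begin
        κ * κ ^ ∣ S ∣ * Ez (G ▷ N) (inside ∷ S) x
          ≈⟨ *-congˡ (Ez-inside G N S x ind) ⟩
        κ * κ ^ ∣ S ∣ * (Ez G S x + x * Ez G S (q * x))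
          ≈⟨ solve 5 (λ k p a x b → k :* p :* (a :+ x :* b) := k :* (p :* a :+ x :* (p :* b)))
               refl κ (κ ^ ∣ S ∣) _ x _ ⟩
        κ * (κ ^ ∣ S ∣ * Ez G S x + x * (κ ^ ∣ S ∣ * Ez G S (q * x)))
          ≤⟨ *-monoˡ-≤ κ 0≤κ (+-mono-≤ ≤C (*-monoˡ-≤ x 0≤x ≤D)) ⟩
        κ * (C + x * D)
          ∎

      -- A vertex of `S` contributes a factor of at most `1# + η`, and the damping cancels it: (1 -
      -- η)(1 + η) ≤ 1.
      bounded-small : ∀ {x} → 0# ≤ x → x ≤ η → Bounded x 1#
      bounded-small 0≤x x≤η ∅ [] ind = ≤.reflexive (*-identityˡ 1#)
      bounded-small 0≤x x≤η (G ▷ N) (outside ∷ S) ind = ≤.trans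
        (≤.reflexive (*-congˡ (Ez-outside G N S _)))
        (bounded-small 0≤x x≤η G S (independent-tail ind))
      bounded-small {x} 0≤x x≤η (G ▷ N) (inside ∷ S) ind = begin
        κ ^ ∣ inside ∷ S ∣ * Ez (G ▷ N) (inside ∷ S) x
          ≤⟨ bounded-inside G N S x 0≤x ind
               (bounded-small 0≤x x≤η G S (independent-tail ind))
               (bounded-small (*-nonNegative 0≤q 0≤x) (≤.trans qx≤x x≤η) G S (independent-tail ind)) ⟩
        κ * (1# + x * 1#)
          ≤⟨ *-monoˡ-≤ κ 0≤κ (+-monoʳ-≤ 1# (*-monoʳ-≤ 1# 0≤1 x≤η)) ⟩
        κ * (1# + η * 1#)
          ≤⟨ ≤-by (η * η) (0≤x² η)
               (solve 1 (λ h → :1 := (:1 :- h) :* (:1 :+ h :* :1) :+ h :* h) refl η) ⟩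
        1#
          ∎
        where
        qx≤x : q * x ≤ x
        qx≤x = ≤.trans (*-monoʳ-≤ x 0≤x q≤1) (≤.reflexive (*-identityˡ x))

      bounded-step : ∀ {x D} → 0# ≤ x → 0# ≤ D → Bounded (q * x) D → Bounded x (1# + x * D * η ⁻¹)
      bounded-step {x} {D} 0≤x 0≤D ≤D = go
        where
        -- All that is required is `κ * (C + x * D) ≤ C`, which follows from `η * C ≈ η + x * D`.
        -- The summand `1#` covers the empty graph.
        C = 1# + x * D * η ⁻¹

        0≤xD/η : 0# ≤ x * D * η ⁻¹
        0≤xD/η = *-nonNegative (*-nonNegative 0≤x 0≤D) (⁻¹-nonNegative η (proj₁ 0<η))

        ηC≈ : η * C ≈ η + x * D
        ηC≈ = trans (solve 3 (λ h y i → h :* (:1 :+ y :* i) := h :+ h :* i :* y) refl η (x * D) (η ⁻¹))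
          (+-congˡ (trans (*-congʳ (*-⁻¹-inverse η λ η≈0 → proj₂ 0<η (sym η≈0))) (*-identityˡ (x * D))))

        go : Bounded x C
        go ∅ [] ind = ≤.trans (≤.reflexive (*-identityˡ 1#)) (x≤x+y 1# 0≤xD/η)
        go (G ▷ N) (outside ∷ S) ind = ≤.trans
          (≤.reflexive (*-congˡ (Ez-outside G N S x))) (go G S (independent-tail ind))
        go (G ▷ N) (inside ∷ S) ind = begin
          κ ^ ∣ inside ∷ S ∣ * Ez (G ▷ N) (inside ∷ S) x
            ≤⟨ bounded-inside G N S x 0≤x ind
                 (go G S (independent-tail ind)) (≤D G S (independent-tail ind)) ⟩
          κ * (C + x * D)
            ≤⟨ ≤-by (η + η * (x * D)) (+-nonNegative (proj₁ 0<η)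
                 (*-nonNegative (proj₁ 0<η) (*-nonNegative 0≤x 0≤D)))
                 (trans (solve 2 (λ C h → C := (:1 :- h) :* C :+ h :* C) refl C η)
                   (trans (+-congˡ ηC≈) (solve 3 (λ C h y →
                     (:1 :- h) :* C :+ (h :+ y) := (:1 :- h) :* (C :+ y) :+ (h :+ h :* y))
                     refl C η (x * D)))) ⟩
          C ∎

      -- Strict positivity of `s` enters here: it makes `q ^ t` drop below `η` for some `t`, where
      -- `bounded-small` applies; `t` uses of `bounded-step` then lead back to weight 1. The
      -- constant depends on `s` and `η` only.
      bounded-unit : 0# < s → ¬ ¬ ∃ λ C → 0# ≤ C × Bounded 1# C
      bounded-unit 0<s = geometric-null 1# (*-pos 0<½ 0<s) ½s≤1 η 0<η >>= λ (t , small) → λ k →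
        k (descend t (1# , 0≤1 , bounded-small (^-nonNegative t 0≤q)
          (≤.trans (≤.reflexive (sym (*-identityʳ (q ^ t)))) (small t ℕ.≤-refl))))
        where
        ½s≤1 : ½ * s ≤ 1#
        ½s≤1 = 0≤y-x⇒x≤y 0≤q

        descend : ∀ t → (∃ λ C → 0# ≤ C × Bounded (q ^ t) C) → ∃ λ C → 0# ≤ C × Bounded 1# C
        descend zero    bound             = bound
        descend (suc t) (C , 0≤C , bound) = descend t
          (_ , +-nonNegative 0≤1 (*-nonNegative (*-nonNegative 0≤qᵗ 0≤C) (⁻¹-nonNegative η (proj₁ 0<η)))
             , bounded-step 0≤qᵗ 0≤C bound)
          where 0≤qᵗ = ^-nonNegative t 0≤q

  -- Rarity of small dominating sets.

  avoid : Subset n → Subset n → Carrier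
  avoid []      []            = 1#
  avoid (b ∷ N) (inside ∷ U)  = if b then 0# else avoid N U
  avoid (b ∷ N) (outside ∷ U) = avoid N U

  avoid-probability : ∀ (N U : Subset n) → IsProbability (avoid N U)
  avoid-probability []          []            = 0≤1 , ≤.refl
  avoid-probability (true  ∷ N) (inside ∷ U)  = ≤.refl , 0≤1
  avoid-probability (false ∷ N) (inside ∷ U)  = avoid-probability N U
  avoid-probability (_ ∷ N)     (outside ∷ U) = avoid-probability N U

  avoid-0-1 : ∀ (N U : Subset n) → (∀ u → u ∈ U → lookup N u ≡ false) ⊎ avoid N U ≈ 0#
  avoid-0-1 []          []            = inj₁ λ _ ()
  avoid-0-1 (true  ∷ N) (inside ∷ U)  = inj₂ refl
  avoid-0-1 (false ∷ N) (inside ∷ U) with avoid-0-1 N U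
  ... | inj₁ disjoint = inj₁ λ { zero u∈U → ≡.refl ; (suc u) (there u∈U) → disjoint u u∈U }
  ... | inj₂ ≈0       = inj₂ ≈0
  avoid-0-1 (_ ∷ N)     (outside ∷ U) with avoid-0-1 N U
  ... | inj₁ disjoint = inj₁ λ { (suc u) (there u∈U) → disjoint u u∈U }
  ... | inj₂ ≈0       = inj₂ ≈0

  -- The product of 1 - c v over all vertices v ∉ U without a neighbour in U.
  -- At c = 1 this is the indicator that U is a dominating set.
  domination : Graph n → (Fin n → Carrier) → Subset n → Carrier
  domination ∅       c []            = 1#
  domination (G ▷ N) c (inside ∷ U)  = domination G (mask N (c ∘ suc)) U
  domination (G ▷ N) c (outside ∷ U) = (1# - c zero * avoid N U) * domination G (c ∘ suc) U

  domination-multiAffine : ∀ (G : Graph n) U → MultiAffine λ c → domination G c U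
  domination-multiAffine ∅       []            = 1# , λ c → refl
  domination-multiAffine (G ▷ N) (inside ∷ U)  =
    _ , _ , multiAffine-scale _ (domination-multiAffine G U) ,
    multiAffine-* 0# (domination-multiAffine G U) , λ c →
      solve 3 (λ a t b → a := a :+ t :* (:0 :* b)) refl _ (c zero) _
  domination-multiAffine (G ▷ N) (outside ∷ U) =
    _ , _ , domination-multiAffine G U ,
    multiAffine-* (- avoid N U) (domination-multiAffine G U) , λ c →
      solve 3 (λ d t a → (:1 :- t :* a) :* d := d :+ t :* (:- a :* d)) refl _ (c zero) (avoid N U)

  domination-nonNegative : ∀ (G : Graph n) {c} U → (∀ v → 0# ≤ c v) → (∀ v → c v ≤ 1#) →
    0# ≤ domination G c U
  domination-nonNegative ∅       []            0≤c c≤1 = 0≤1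
  domination-nonNegative (G ▷ N) (inside ∷ U)  0≤c c≤1 =
    domination-nonNegative G U (mask-nonNegative N (0≤c ∘ suc)) (mask-≤1 N (c≤1 ∘ suc))
  domination-nonNegative (G ▷ N) (outside ∷ U) 0≤c c≤1 with avoid-probability N U
  ... | 0≤a , a≤1 = *-nonNegative
    (x≤y⇒0≤y-x (*-≤1 0≤a (c≤1 zero) a≤1))
    (domination-nonNegative G U (0≤c ∘ suc) (c≤1 ∘ suc))

  -- General weights are forced by the induction, which masks the neighbours of each member of `U`
  -- that it peels off: starting from weight 1, `c v ≉ 0#` records that no such member is adjacent
  -- to `v`.
  undominated-or-1≤domination : ∀ (G : Graph n) c U →
    (∃ λ v → v ∉ U × c v ≉ 0# × (∀ u → u ∈ U → adjacent G v u ≡ false)) ⊎ 1# ≤ domination G c U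
  undominated-or-1≤domination ∅       c []           = inj₂ ≤.refl
  undominated-or-1≤domination (G ▷ N) c (inside ∷ U)
    with undominated-or-1≤domination G (mask N (c ∘ suc)) U
  ... | inj₂ 1≤dom = inj₂ 1≤dom
  ... | inj₁ (v , v∉U , cv≉0 , free) with lookup N v in Nv
  ...   | true  = contradiction (zeroˡ _) cv≉0
  ...   | false = inj₁ (suc v , (λ { (there v∈U) → v∉U v∈U }) ,
    (λ cv≈0 → cv≉0 (trans (*-congˡ cv≈0) (zeroʳ 1#))) ,
    λ { zero _ → Nv ; (suc u) (there u∈U) → free u u∈U })
  undominated-or-1≤domination (G ▷ N) c (outside ∷ U)
    with undominated-or-1≤domination G (c ∘ suc) U
  ... | inj₁ (v , v∉U , cv≉0 , free) = inj₁ (suc v , (λ { (there v∈U) → v∉U v∈U }) , cv≉0 ,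
    λ { (suc u) (there u∈U) → free u u∈U })
  ... | inj₂ 1≤dom with c zero ≤.≟ 0# | avoid-0-1 N U
  ...   | no c₀≉0  | inj₁ disjoint = inj₁ (zero , (λ ()) , c₀≉0 ,
    λ { (suc u) (there u∈U) → disjoint u u∈U })
  ...   | yes c₀≈0 | _         = inj₂ (≤.trans 1≤dom (≤.reflexive (sym (trans
    (*-congʳ (+-congˡ (-‿cong (*-congʳ c₀≈0))))
    (solve 2 (λ a d → (:1 :- :0 :* a) :* d := d) refl _ _)))))
  ...   | no _     | inj₂ a≈0 = inj₂ (≤.trans 1≤dom (≤.reflexive (sym (trans
    (*-congʳ (+-congˡ (-‿cong (*-congˡ a≈0))))
    (solve 2 (λ a d → (:1 :- a :* :0) :* d := d) refl _ _)))))

  -- The indicator of ∣ U ∣ < r.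
  small : ℕ → Subset n → Carrier
  small zero    U             = 0#
  small (suc r) []            = 1#
  small (suc r) (inside ∷ U)  = small r U
  small (suc r) (outside ∷ U) = small (suc r) U

  small-nonNegative : ∀ r (U : Subset n) → 0# ≤ small r U
  small-nonNegative zero    U             = ≤.refl
  small-nonNegative (suc r) []            = 0≤1
  small-nonNegative (suc r) (inside ∷ U)  = small-nonNegative r U
  small-nonNegative (suc r) (outside ∷ U) = small-nonNegative (suc r) U

  small≈1 : ∀ {r} (U : Subset n) → ∣ U ∣ ℕ.< r → small r U ≈ 1#
  small≈1 {r = suc r} []            _              = refl
  small≈1 {r = suc r} (inside ∷ U)  (ℕ.s≤s ∣U∣<r) = small≈1 U ∣U∣<r
  small≈1 {r = suc r} (outside ∷ U) ∣U∣<1+r       = small≈1 U ∣U∣<1+r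

  -- A uniform row misses `U` with probability 2 to the power -|U|. The factor `small r U` on both
  -- sides plays the part of the hypothesis |U| < r.
  small-avoid : ∀ r (U : Subset n) →
    small r U * ½ ^ r ≤ small r U * randomRow n λ N → avoid N U
  small-avoid zero    U  = ≤.reflexive (trans (zeroˡ _) (sym (zeroˡ _)))
  small-avoid (suc r) [] = *-monoˡ-≤ 1# 0≤1 (^-≤1 (suc r) (proj₁ 0<½) ½≤1)
  small-avoid {suc n} (suc r) (inside ∷ U) = begin
    small r U * (½ * ½ ^ r)
      ≈⟨ solve 3 (λ s h p → s :* (h :* p) := h :* (s :* p)) refl _ ½ _ ⟩
    ½ * (small r U * ½ ^ r)
      ≤⟨ *-monoˡ-≤ ½ (proj₁ 0<½) (small-avoid r U) ⟩
    ½ * (small r U * randomRow n λ N → avoid N U)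
      ≈⟨ solve 3 (λ s h p → h :* (s :* p) := s :* (h :* :0 :+ h :* p)) refl _ ½ _ ⟩
    small r U * (½ * 0# + ½ * randomRow n λ N → avoid N U)
      ≈⟨ *-congˡ (+-cong (*-congˡ (randomRow-total n 0#)) (*-congʳ 1-½≈½)) ⟨
    small r U * (½ * randomRow n (λ N → 0#) + (1# - ½) * randomRow n λ N → avoid N U)
      ∎
  small-avoid {suc n} (suc r) (outside ∷ U) = ≤.trans (small-avoid (suc r) U)
    (≤.reflexive (*-congˡ (sym (bernoulli-total ½ _))))

  -- At `c = 1#` this counts the dominating sets with fewer than `r` vertices. Other values of `c`
  -- arise in the recursion over vertices.
  smallDominating : ℕ → Carrier → Graph n → Carrier
  smallDominating r c G = ∑⊆ λ U → small r U * domination G (λ _ → c) U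

  -- If the new vertex is outside `U`, it has no neighbour there with probability at least
  -- `½ ^ suc r`, which costs the factor `1# - c * ½ ^ suc r`. If it is inside, fewer than `r` old
  -- vertices remain in `U`, and it dominates each old vertex with probability ½, so the mean weight
  -- is `½ * c`.
  smallDominating-step : ∀ r n {c} → IsProbability c →
    G[ suc n ,½] (smallDominating (suc r) c) ≤
    (1# - c * ½ ^ suc r) * G[ n ,½] (smallDominating (suc r) c) + G[ n ,½] (smallDominating r (½ * c))
  smallDominating-step r n {c} (0≤c , c≤1) = begin
    (G[ n ,½] λ G → randomRow n λ N → smallDominating (suc r) c (G ▷ N))
      ≤⟨ mono (G-integral n) row ⟩
    (G[ n ,½] λ G → (1# - c * ½ ^ suc r) * smallDominating (suc r) c G + smallDominating r (½ * c) G)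
      ≈⟨ trans (+-homo (G-integral n) _ _) (+-congʳ (*-homo (G-integral n) _ _)) ⟩
    (1# - c * ½ ^ suc r) * G[ n ,½] (smallDominating (suc r) c) + G[ n ,½] (smallDominating r (½ * c))
      ∎
    where
    row-inside : ∀ (G : Graph n) → randomRow n (λ N → ∑⊆ λ U → small r U * domination G (mask N λ _ → c) U) ≈
      smallDominating r (½ * c) G
    row-inside G = trans (fubini (randomRow-integral n) (isLinear (∑⊆-integral n)) _) (∑⊆-cong λ U →
      trans (*-homo (randomRow-integral n) _ _) (*-congˡ (trans (randomRow≈rowLaw n _)
        (trans (rowLaw-mask (domination-multiAffine G U) _ _)
          (multiAffine-cong (domination-multiAffine G U) λ v → *-congʳ 1-½≈½)))))

    term : ∀ (G : Graph n) U →
      randomRow n (λ N → small (suc r) U * ((1# - c * avoid N U) * domination G (λ _ → c) U)) ≤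
      (1# - c * ½ ^ suc r) * (small (suc r) U * domination G (λ _ → c) U)
    term G U = begin
      randomRow n (λ N → small (suc r) U * ((1# - c * avoid N U) * d))
        ≈⟨ cong (randomRow-integral n) (λ N → solve 4
             (λ s c a d → s :* ((:1 :- c :* a) :* d) := s :* d :+ :- (c :* s :* d) :* a)
             refl (small (suc r) U) c (avoid N U) d) ⟩
      randomRow n (λ N → small (suc r) U * d + - (c * small (suc r) U * d) * avoid N U)
        ≈⟨ trans (+-homo (randomRow-integral n) _ _)
             (+-cong (randomRow-total n _) (*-homo (randomRow-integral n) _ _)) ⟩
      small (suc r) U * d + - (c * small (suc r) U * d) * randomRow n (λ N → avoid N U)
        ≤⟨ ≤-by (c * d * (small (suc r) U * randomRow n (λ N → avoid N U) - small (suc r) U * ½ ^ suc r))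
             (*-nonNegative (*-nonNegative 0≤c (domination-nonNegative G U (λ _ → 0≤c) (λ _ → c≤1)))
               (x≤y⇒0≤y-x (small-avoid (suc r) U)))
             (solve 5 (λ s d c a p → (:1 :- c :* p) :* (s :* d)
               := s :* d :+ :- (c :* s :* d) :* a :+ c :* d :* (s :* a :- s :* p))
               refl (small (suc r) U) d c _ (½ ^ suc r)) ⟩
      (1# - c * ½ ^ suc r) * (small (suc r) U * d)
        ∎
      where d = domination G (λ _ → c) U

    row : ∀ (G : Graph n) → randomRow n (λ N → smallDominating (suc r) c (G ▷ N)) ≤
      (1# - c * ½ ^ suc r) * smallDominating (suc r) c G + smallDominating r (½ * c) G
    row G = begin
      randomRow n (λ N → smallDominating (suc r) c (G ▷ N))
        ≈⟨ +-homo (randomRow-integral n) _ _ ⟩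
      randomRow n (λ N → ∑⊆ λ U → small r U * domination G (mask N λ _ → c) U) +
      randomRow n (λ N → ∑⊆ λ U → small (suc r) U * ((1# - c * avoid N U) * domination G (λ _ → c) U))
        ≈⟨ +-cong (row-inside G) (fubini (randomRow-integral n) (isLinear (∑⊆-integral n)) _) ⟩
      smallDominating r (½ * c) G +
      ∑⊆ (λ U → randomRow n λ N → small (suc r) U * ((1# - c * avoid N U) * domination G (λ _ → c) U))
        ≤⟨ +-monoʳ-≤ _ (mono (∑⊆-integral n) (term G)) ⟩
      smallDominating r (½ * c) G +
      ∑⊆ (λ U → (1# - c * ½ ^ suc r) * (small (suc r) U * domination G (λ _ → c) U))
        ≈⟨ trans (+-comm _ _) (+-congʳ (∑⊆-distribˡ {n} _ _)) ⟩
      (1# - c * ½ ^ suc r) * smallDominating (suc r) c G + smallDominating r (½ * c) G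
        ∎

  -- Induction on `r` for all `c` at once: the inside term is null by the induction hypothesis at
  -- `½ * c`, and the outside term is a contraction.
  smallDominating-null : ∀ r {c} → 0# < c → c ≤ 1# → Null λ n → G[ n ,½] (smallDominating r c)
  smallDominating-null zero {c} 0<c c≤1 ε 0<ε k = k (0 , λ n _ → ≤.trans (≤.reflexive (trans
    (cong (G-integral n) λ G → trans (∑⊆-distribˡ {n} 0# _) (zeroˡ _)) (G-total n 0#))) (proj₁ 0<ε))
  smallDominating-null (suc r) {c} 0<c@(0≤c , _) c≤1 = contraction-null
    (*-pos 0<c (^-pos (suc r) 0<½))
    (*-≤1 (^-nonNegative (suc r) (proj₁ 0<½)) c≤1 (^-≤1 (suc r) (proj₁ 0<½) ½≤1))
    (λ n → smallDominating-step r n (0≤c , c≤1))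
    (smallDominating-null r (*-pos 0<½ 0<c) (*-≤1 0≤c ½≤1 c≤1))

-- Extending independent sets, and their mean size.

Free : ∀ {n} → Graph n → Subset n → Fin n → Set
Free G S v = ∀ u → u ∈ S → adjacent G v u ≡ false

free? : ∀ {n} (G : Graph n) S v → Dec (Free G S v)
free? G S v = Fin.all? λ u → (u ∈? S) →-dec (adjacent G v u Bool.≟ false)

independent⇒free : ∀ {n} (G : Graph n) {W} → Independent G W → ∀ v → v ∈ W → Free G W v
independent⇒free G ind v v∈W u u∈W with adjacent G v u in eq
... | false = ≡.refl
... | true  = contradiction (≡.subst T (≡.sym eq) _) (ind v v∈W u u∈W)

-- `W` is bounded only from above, so the lemma covers the insertion of a vertex as well as the
-- undoing of a toggle.
independent-insert : ∀ {n} (G : Graph n) {S W v} → Independent G S → Free G S v →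
  (∀ u → u ∈ W → u ≡ v ⊎ u ∈ S) → Independent G W
independent-insert G {v = v} ind free W⊆ i i∈W j j∈W adj with W⊆ i i∈W | W⊆ j j∈W
... | inj₁ ≡.refl | inj₁ ≡.refl = ≡.subst T (adjacent-irrefl G v) adj
... | inj₁ ≡.refl | inj₂ j∈S    = ≡.subst T (free j j∈S) adj
... | inj₂ i∈S    | inj₁ ≡.refl = ≡.subst T (≡.trans (adjacent-sym G i v) (free i i∈S)) adj
... | inj₂ i∈S    | inj₂ j∈S    = ind i i∈S j j∈S adj

-- Equivalent to every maximal independent set having at least `r` vertices, but it supplies the
-- extension `W` directly.
ExtendsTo : ∀ {n} → Graph n → ℕ → Set
ExtendsTo G r = ∀ S → Independent G S → ∃ λ W → Independent G W × S ⊆ W × r ℕ.≤ ∣ W ∣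

extend-by-one : ∀ {n} (G : Graph n) {S v} → Independent G S → v ∉ S → Free G S v →
  ∃ λ W → Independent G W × S ⊆ W × ∣ S ∣ ℕ.< ∣ W ∣
extend-by-one G {S} {v} ind v∉S free =
  S [ v ]≔ inside , independent-insert G ind free split , S⊆W ,
  p⊂q⇒∣p∣<∣q∣ (S⊆W , v , []≔-updates S v , v∉S)
  where
  S⊆W : S ⊆ S [ v ]≔ inside
  S⊆W {u} u∈S = []≔-minimal S u v (λ { ≡.refl → v∉S u∈S }) u∈S

  split : ∀ u → u ∈ S [ v ]≔ inside → u ≡ v ⊎ u ∈ S
  split u u∈W with u Fin.≟ v
  ... | yes u≡v = inj₁ u≡v
  ... | no  u≢v = inj₂ (lookup⇒[]= u S (≡.trans
    (≡.sym (lookup∘updateAt′ u v u≢v S)) ([]=⇒lookup u∈W)))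

-- The worst-case bound on nonempty graphs. It keeps second moments positive, and it bounds their
-- inverses on the rare graphs that have a small dominating set.
extendsTo-1 : ∀ {n} (G : Graph (suc n)) → ExtendsTo G 1
extendsTo-1 G S ind with nonempty? S
... | yes (v , v∈S) = S , ind , ⊆-refl , ℕ.≤-trans (ℕ.s≤s ℕ.z≤n) (x∈p⇒∣p-x∣<∣p∣ v∈S)
... | no  empty with extend-by-one G ind (λ 0∈S → empty (zero , 0∈S)) (λ u u∈S → contradiction (u , u∈S) empty)
...   | W , W-ind , S⊆W , ∣S∣<∣W∣ = W , W-ind , S⊆W , ℕ.≤-trans (ℕ.s≤s ℕ.z≤n) ∣S∣<∣W∣

module Hardcore {c ℓ₁ ℓ₂} (ℝ : CompleteOrderedField c ℓ₁ ℓ₂) where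

  open Real ℝ hiding (zero)
  open RingSolver ℝ
  open OrderedField ℝ
  open Laws ℝ
  open GraphPolynomials ℝ
  open Relation.Binary.Reasoning.PartialOrder (DecTotalOrder.poset decTotalOrder)

  private
    variable
      n : ℕ

  -- An independent set that admits no further vertex is dominating. If it has fewer than `r`
  -- vertices, its term alone brings the count up to 1.
  extends-or-dominated : ∀ r (G : Graph n) → ExtendsTo G r ⊎ 1# ≤ smallDominating r 1# G
  extends-or-dominated {n} r G with 1# ≤.≤? smallDominating r 1# G
  ... | yes 1≤ = inj₂ 1≤
  ... | no  1≰ = inj₁ λ S ind → extend r S ind (ℕ.m≤m+n r ∣ S ∣)
    where
    -- `d` is fuel: each added vertex lowers it by one while preserving r ≤ d + |S|.
    extend : ∀ d S → Independent G S → r ℕ.≤ d ℕ.+ ∣ S ∣ →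
      ∃ λ W → Independent G W × S ⊆ W × r ℕ.≤ ∣ W ∣
    extend zero    S ind r≤ = S , ind , ⊆-refl , r≤
    extend (suc d) S ind r≤ with r ℕ.≤? ∣ S ∣
    ... | yes r≤∣S∣ = S , ind , ⊆-refl , r≤∣S∣
    ... | no  r≰∣S∣ with undominated-or-1≤domination G (λ _ → 1#) S
    ...   | inj₂ 1≤dom = contradiction (begin
      1#                                       ≤⟨ 1≤dom ⟩
      domination G (λ _ → 1#) S                ≈⟨ *-identityˡ _ ⟨
      1# * domination G (λ _ → 1#) S           ≈⟨ *-congʳ (small≈1 S (ℕ.≰⇒> r≰∣S∣)) ⟨
      small r S * domination G (λ _ → 1#) S    ≤⟨ term≤∑⊆ (λ U → *-nonNegative (small-nonNegative r U)
        (domination-nonNegative G U (λ _ → 0≤1) (λ _ → ≤.refl))) S ⟩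
      smallDominating r 1# G                   ∎) 1≰
    ...   | inj₁ (v , v∉S , _ , free) with extend-by-one G ind v∉S free
    ...     | S′ , ind′ , S⊆S′ , ∣S∣<∣S′∣
              with extend d S′ ind′ (ℕ.≤-trans r≤ (ℕ.≤-trans
                (ℕ.≤-reflexive (≡.sym (ℕ.+-suc d ∣ S ∣))) (ℕ.+-monoʳ-≤ d ∣S∣<∣S′∣)))
    ...       | W , W-ind , S′⊆W , r≤∣W∣ = W , W-ind , ⊆-trans S⊆S′ S′⊆W , r≤∣W∣

  ∑⊆-toggle : ∀ v (f : Subset n → Carrier) → ∑⊆ f ≈ ∑⊆ λ S → f (updateAt S v not)
  ∑⊆-toggle zero    f = +-comm _ _
  ∑⊆-toggle (suc v) f = +-cong (∑⊆-toggle v (f ∘ (inside ∷_))) (∑⊆-toggle v (f ∘ (outside ∷_)))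

  ‖indicator‖² : ∀ (S : Subset n) → ‖ indicator S ‖² ≈ ι ∣ S ∣
  ‖indicator‖² []            = refl
  ‖indicator‖² (inside ∷ S)  = +-cong (*-identityˡ 1#) (‖indicator‖² S)
  ‖indicator‖² (outside ∷ S) = trans (+-cong (zeroˡ 0#) (‖indicator‖² S)) (+-identityˡ _)

  𝟙 : ∀ {p} {P : Set p} → Dec P → Carrier
  𝟙 P? = if does P? then 1# else 0#

  𝟙-nonNegative : ∀ {p} {P : Set p} (P? : Dec P) → 0# ≤ 𝟙 P?
  𝟙-nonNegative (yes _) = 0≤1
  𝟙-nonNegative (no _)  = ≤.refl

  𝟙-≤1 : ∀ {p} {P : Set p} (P? : Dec P) → 𝟙 P? ≤ 1#
  𝟙-≤1 (yes _) = ≤.refl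
  𝟙-≤1 (no _)  = 0≤1

  1≤𝟙 : ∀ {p} {P : Set p} (P? : Dec P) → P → 1# ≤ 𝟙 P?
  1≤𝟙 (yes _) p = ≤.refl
  1≤𝟙 (no ¬p) p = contradiction p ¬p

  𝟙≈0 : ∀ {p} {P : Set p} (P? : Dec P) → ¬ P → 𝟙 P? ≈ 0#
  𝟙≈0 (yes p) ¬p = contradiction p ¬p
  𝟙≈0 (no _)  ¬p = refl

  𝟙-*-≤ : ∀ {p q r} {P : Set p} {Q : Set q} {R : Set r} (P? : Dec P) (Q? : Dec Q) (R? : Dec R) →
    (P → Q → R) → 𝟙 P? * 𝟙 Q? ≤ 𝟙 R?
  𝟙-*-≤ (yes p) (yes q) R? pqr = ≤.trans (≤.reflexive (*-identityˡ 1#)) (1≤𝟙 R? (pqr p q))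
  𝟙-*-≤ (yes p) (no _)  R? pqr = ≤.trans (≤.reflexive (zeroʳ 1#)) (𝟙-nonNegative R?)
  𝟙-*-≤ (no _)  Q?      R? pqr = ≤.trans (≤.reflexive (zeroˡ (𝟙 Q?))) (𝟙-nonNegative R?)

  toggle-bound : ∀ (G : Graph n) v →
    (∑⊆ λ S → 𝟙-independent G S * 𝟙 (free? G S v)) ≤
    2# * (∑⊆ λ S → 𝟙-independent G S * (indicator S v) ²)
  toggle-bound {n} G v = begin
    (∑⊆ λ S → 𝟙-independent G S * 𝟙 (free? G S v))
      ≤⟨ mono (∑⊆-integral n) split ⟩
    (∑⊆ λ S → with-v S + without-v S)
      ≈⟨ +-homo (∑⊆-integral n) with-v without-v ⟩
    ∑⊆ with-v + ∑⊆ without-v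
      -- After reindexing, a nonzero term has `v` in `S` and the independent set `S` minus `v`, to
      -- which `v` has no neighbour; `insert` then returns `v`.
      ≈⟨ +-congˡ (∑⊆-toggle v without-v) ⟩
    ∑⊆ with-v + (∑⊆ λ S → without-v (updateAt S v not))
      ≤⟨ +-monoʳ-≤ _ (mono (∑⊆-integral n) insert) ⟩
    ∑⊆ with-v + ∑⊆ with-v
      ≈⟨ solve 1 (λ x → x :+ x := :2 :* x) refl (∑⊆ with-v) ⟩
    2# * ∑⊆ with-v
      ∎
    where
    with-v without-v : Subset n → Carrier
    with-v    S = 𝟙-independent G S * (indicator S v) ²
    without-v S = 𝟙-independent G S * 𝟙 (free? G S v) * (1# - indicator S v)

    split : ∀ S → 𝟙-independent G S * 𝟙 (free? G S v) ≤ with-v S + without-v S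
    split S with lookup S v
    ... | true  = begin
      i * f                         ≤⟨ *-monoˡ-≤ i (0≤𝟙 G S) (𝟙-≤1 (free? G S v)) ⟩
      i * 1#                        ≈⟨ solve 2 (λ i f → i :* :1 := i :* (:1 :* :1) :+ i :* f :* (:1 :- :1)) refl i f ⟩
      i * 1# ² + i * f * (1# - 1#)  ∎
      where
      i = 𝟙-independent G S
      f = 𝟙 (free? G S v)
    ... | false = ≤.reflexive
      (solve 2 (λ i f → i :* f := i :* (:0 :* :0) :+ i :* f :* (:1 :- :0)) refl _ _)

    insert : ∀ S → without-v (updateAt S v not) ≤ with-v S
    insert S rewrite lookup∘updateAt v {not} S with lookup S v in v∈S
    ... | false = ≤.reflexive (solve 2 (λ i j → i :* (:1 :- :1) := j :* (:0 :* :0)) refl _ _)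
    ... | true  = begin
      𝟙 (independent? G S′) * 𝟙 (free? G S′ v) * (1# - 0#)
        ≈⟨ solve 1 (λ x → x :* (:1 :- :0) := x) refl _ ⟩
      𝟙 (independent? G S′) * 𝟙 (free? G S′ v)
        ≤⟨ 𝟙-*-≤ (independent? G S′) (free? G S′ v) (independent? G S)
             (λ ind free → independent-insert G ind free back) ⟩
      𝟙 (independent? G S)
        ≈⟨ solve 1 (λ x → x := x :* (:1 :* :1)) refl _ ⟩
      𝟙 (independent? G S) * 1# ²
        ∎
      where
      S′ = updateAt S v not
      back : ∀ u → u ∈ S → u ≡ v ⊎ u ∈ S′
      back u u∈S with u Fin.≟ v
      ... | yes u≡v = inj₁ u≡v
      ... | no  u≢v = inj₂ (updateAt-minimal u v S u≢v u∈S)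

  mass-zero : ∀ (G : Graph n) S → ¬ Independent G S → mass (hardcore G) S ≈ 0#
  mass-zero G S dependent = trans (*-congˡ (𝟙≈0 (independent? G S) dependent)) (zeroʳ _)

  -- Double counting of the pairs of an independent `S` and a vertex free for it. All members of the
  -- extension `W` are free for `S`, those of `S` included, which gives at least `r` pairs per `S`;
  -- `toggle-bound` limits the pairs per vertex.
  secondMoment-large : ∀ (G : Graph n) {r} → ExtendsTo G r → ι r ≤ 2# * secondMoment (hardcore G)
  secondMoment-large {n} G {r} extends = begin
    ι r
      ≈⟨ *-identityʳ (ι r) ⟨
    ι r * 1#
      ≈⟨ *-congˡ (total (hardcore G)) ⟨
    ι r * ∑⊆ (mass (hardcore G))
      ≈⟨ ∑⊆-distribˡ (ι r) (mass (hardcore G)) ⟨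
    (∑⊆ λ S → ι r * mass (hardcore G) S)
      ≤⟨ mono (∑⊆-integral n) pointwise ⟩
    (∑⊆ λ S → mass (hardcore G) S * sum λ v → 𝟙 (free? G S v))
      ≈⟨ (∑⊆-cong {n} λ S → trans (*-assoc Z⁻¹ _ _) (*-congˡ (sym (*-homo (sum-integral n) _ _)))) ⟩
    (∑⊆ λ S → Z⁻¹ * sum λ v → 𝟙-independent G S * 𝟙 (free? G S v))
      ≈⟨ ∑⊆-distribˡ {n} Z⁻¹ _ ⟩
    Z⁻¹ * (∑⊆ λ S → sum λ v → 𝟙-independent G S * 𝟙 (free? G S v))
      ≈⟨ *-congˡ (fubini (∑⊆-integral n) (isLinear (sum-integral n)) _) ⟩
    Z⁻¹ * (sum λ v → ∑⊆ λ S → 𝟙-independent G S * 𝟙 (free? G S v))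
      ≤⟨ *-monoˡ-≤ Z⁻¹ 0≤Z⁻¹ (mono (sum-integral n) (toggle-bound G)) ⟩
    Z⁻¹ * (sum λ v → 2# * ∑⊆ λ S → 𝟙-independent G S * (indicator S v) ²)
      ≈⟨ *-congˡ (trans (*-homo (sum-integral n) 2# _) (*-congˡ
           (trans (fubini (sum-integral n) (isLinear (∑⊆-integral n)) _)
             (∑⊆-cong {n} λ S → *-homo (sum-integral n) _ _)))) ⟩
    Z⁻¹ * (2# * ∑⊆ λ S → 𝟙-independent G S * ‖ indicator S ‖²)
      ≈⟨ solve 2 (λ z x → z :* (:2 :* x) := :2 :* (z :* x)) refl Z⁻¹ _ ⟩
    2# * (Z⁻¹ * ∑⊆ λ S → 𝟙-independent G S * ‖ indicator S ‖²)
      ≈⟨ *-congˡ (trans (sym (∑⊆-distribˡ {n} Z⁻¹ _)) (∑⊆-cong {n} λ S → sym (*-assoc Z⁻¹ _ _))) ⟩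
    2# * secondMoment (hardcore G)
      ∎
    where
    Z⁻¹ = (#independent G) ⁻¹
    0≤Z⁻¹ = ⁻¹-nonNegative _ (≤.trans 0≤1 (1≤#independent G))

    indicator≤𝟙free : ∀ {S W} → Independent G W → S ⊆ W → ∀ v → (indicator W v) ² ≤ 𝟙 (free? G S v)
    indicator≤𝟙free {S} {W} ind S⊆W v with lookup W v in v∈W
    ... | false = ≤.trans (≤.reflexive (zeroˡ 0#)) (𝟙-nonNegative (free? G S v))
    ... | true  = ≤.trans (≤.reflexive (*-identityˡ 1#)) (1≤𝟙 (free? G S v)
      λ u u∈S → independent⇒free G ind v (lookup⇒[]= v W v∈W) u (S⊆W u∈S))

    pointwise : ∀ S → ι r * mass (hardcore G) S ≤ mass (hardcore G) S * sum λ v → 𝟙 (free? G S v)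
    pointwise S = split (independent? G S)
      where
      split : Dec (Independent G S) → ι r * mass (hardcore G) S ≤ mass (hardcore G) S * sum λ v → 𝟙 (free? G S v)
      split (no dependent) = ≤.reflexive (trans
        (trans (*-congˡ (mass-zero G S dependent)) (zeroʳ (ι r)))
        (sym (trans (*-congʳ (mass-zero G S dependent)) (zeroˡ _))))
      split (yes ind) with extends S ind
      ... | W , W-ind , S⊆W , r≤∣W∣ = begin
        ι r * mass (hardcore G) S                         ≈⟨ *-comm _ _ ⟩
        mass (hardcore G) S * ι r                         ≤⟨ *-monoˡ-≤ _ (nonNegative (hardcore G) S) (begin
          ι r                                               ≤⟨ ι-mono-≤ r≤∣W∣ ⟩
          ι ∣ W ∣                                           ≈⟨ ‖indicator‖² W ⟨
          ‖ indicator W ‖²                                  ≤⟨ mono (sum-integral n) (indicator≤𝟙free W-ind S⊆W) ⟩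
          (sum λ v → 𝟙 (free? G S v))                       ∎) ⟩
        mass (hardcore G) S * (sum λ v → 𝟙 (free? G S v)) ∎

  normalisation : ProbMeasure n → Carrier
  normalisation μ = (√ (secondMoment μ)) ⁻¹

  -- Positivity keeps the inverse away from its default value at 0.
  normalisation-² : ∀ (μ : ProbMeasure n) → 0# < secondMoment μ →
    (normalisation μ) ² * secondMoment μ ≈ 1#
  normalisation-² μ (0≤m , 0≉m) = trans (*-congˡ (sym √²≈m))
    (trans (solve 2 (λ a x → a :* a :* (x :* x) := (x :* a) :* (x :* a)) refl _ (√ secondMoment μ))
      (trans (*-cong √*⁻¹≈1 √*⁻¹≈1) (*-identityˡ 1#)))
    where
    √²≈m = √-² 0≤m
    √*⁻¹≈1 = *-⁻¹-inverse (√ secondMoment μ) λ √≈0 →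
      0≉m (trans (sym (trans (*-congʳ √≈0) (zeroˡ _))) √²≈m)

  secondMoment-pos : ∀ (G : Graph (suc n)) → 0# < secondMoment (hardcore G)
  secondMoment-pos G = 0≤m , λ 0≈m → 1≰0 (begin
    1#                             ≈⟨ +-identityʳ 1# ⟨
    ι 1                            ≤⟨ secondMoment-large G (extendsTo-1 G) ⟩
    2# * secondMoment (hardcore G) ≈⟨ trans (*-congˡ (sym 0≈m)) (zeroʳ 2#) ⟩
    0#                             ∎)
    where
    0≤m : 0# ≤ secondMoment (hardcore G)
    0≤m = *-cancelˡ-≤ 2# 0<2 (begin
      2# * 0#                        ≈⟨ zeroʳ 2# ⟩
      0#                             ≤⟨ ι-nonNegative 1 ⟩
      ι 1                            ≤⟨ secondMoment-large G (extendsTo-1 G) ⟩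
      2# * secondMoment (hardcore G) ∎)

  inverseSecondMoment : Graph n → Carrier
  inverseSecondMoment G = (normalisation (hardcore G)) ²

  inverseSecondMoment-small : ∀ (G : Graph (suc n)) {r} → ExtendsTo G r →
    ι r * inverseSecondMoment G ≤ 2#
  inverseSecondMoment-small G {r} extends = begin
    ι r * a²                               ≤⟨ *-monoʳ-≤ a² (0≤x² _) (secondMoment-large G extends) ⟩
    2# * secondMoment (hardcore G) * a²    ≈⟨ solve 2 (λ m a → :2 :* m :* a := :2 :* (a :* m)) refl _ a² ⟩
    2# * (a² * secondMoment (hardcore G))  ≈⟨ *-congˡ (normalisation-² (hardcore G) (secondMoment-pos G)) ⟩
    2# * 1#                                ≈⟨ *-identityʳ 2# ⟩
    2#                                     ∎
    where a² = inverseSecondMoment G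

  -- Markov's inequality in pointwise form: the crude bound on the exceptional graphs is charged to
  -- the count, so the right side can be averaged linearly.
  inverseSecondMoment-bound : ∀ r (G : Graph (suc n)) →
    ι r * inverseSecondMoment G ≤ 2# + 2# * ι r * smallDominating r 1# G
  inverseSecondMoment-bound r G with extends-or-dominated r G
  ... | inj₁ extends = ≤.trans (inverseSecondMoment-small G extends)
    (x≤x+y 2# (*-nonNegative (*-nonNegative (proj₁ 0<2) (ι-nonNegative r))
      (∑⊆-nonNegative λ U → *-nonNegative (small-nonNegative r U)
        (domination-nonNegative G U (λ _ → 0≤1) (λ _ → ≤.refl)))))
  ... | inj₂ 1≤dom = begin
    ι r * a²                                  ≈⟨ *-congˡ
      (trans (sym (*-identityˡ a²)) (*-congʳ (sym (+-identityʳ 1#)))) ⟩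
    ι r * (ι 1 * a²)                          ≤⟨ *-monoˡ-≤ (ι r) (ι-nonNegative r)
      (inverseSecondMoment-small G (extendsTo-1 G)) ⟩
    ι r * 2#                                  ≈⟨ solve 1 (λ r → r :* :2 := :2 :* r :* :1) refl (ι r) ⟩
    2# * ι r * 1#                             ≤⟨ *-monoˡ-≤ _ (*-nonNegative (proj₁ 0<2) (ι-nonNegative r)) 1≤dom ⟩
    2# * ι r * smallDominating r 1# G         ≤⟨ x≤y+x _ (proj₁ 0<2) ⟩
    2# + 2# * ι r * smallDominating r 1# G    ∎
    where a² = inverseSecondMoment G

-- Transport cost of a coupling.

module Transport {c ℓ₁ ℓ₂} (ℝ : CompleteOrderedField c ℓ₁ ℓ₂) where

  open Real ℝ hiding (zero)
  open RingSolver ℝ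
  open OrderedField ℝ
  open Laws ℝ
  open GraphPolynomials ℝ
  open Hardcore ℝ
  open Algebra.Properties.CommutativeSemiring.Exp commutativeSemiring using (^-distrib-*)
  open Relation.Binary.Reasoning.PartialOrder (DecTotalOrder.poset decTotalOrder)

  private
    variable
      n : ℕ

  couplingLaw : {μ ν : ProbMeasure n} → Coupling μ ν → Law (Subset n × Subset n)
  couplingLaw π f = ∑⊆ λ S → ∑⊆ λ T → joint π S T * f (S , T)

  couplingLaw-integral : {μ ν : ProbMeasure n} (π : Coupling μ ν) → IsIntegral (couplingLaw π)
  couplingLaw-integral {n} π = bind-integral (∑⊆-integral n) λ S → bind-integral (∑⊆-integral n) λ T →
    scale-integral (jointNonNegative π S T) (eval-integral (S , T))

  couplingLaw-left : {μ ν : ProbMeasure n} (π : Coupling μ ν) (f : Subset n → Carrier) →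
    couplingLaw π (λ (S , T) → f S) ≈ ∑⊆ λ S → mass μ S * f S
  couplingLaw-left {n} π f = ∑⊆-cong {n} λ S →
    trans (IsLinear.*-homoʳ (isLinear (∑⊆-integral n)) _ (f S)) (*-congʳ (marginalˡ π S))

  couplingLaw-right : {μ ν : ProbMeasure n} (π : Coupling μ ν) (f : Subset n → Carrier) →
    couplingLaw π (λ (S , T) → f T) ≈ ∑⊆ λ T → mass ν T * f T
  couplingLaw-right {n} π f = trans (fubini (∑⊆-integral n) (isLinear (∑⊆-integral n)) _)
    (∑⊆-cong {n} λ T →
      trans (IsLinear.*-homoʳ (isLinear (∑⊆-integral n)) _ (f T)) (*-congʳ (marginalʳ π T)))

  displacement : (μ ν : ProbMeasure n) → Subset n × Subset n → Carrier
  displacement μ ν (S , T) = ‖ (λ i → normalized μ S i - normalized ν T i) ‖²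

  0≤‖x‖² : ∀ (x : Fin n → Carrier) → 0# ≤ ‖ x ‖²
  0≤‖x‖² {n} x = nonneg (sum-integral n) λ i → 0≤x² (x i)

  squaredCost : {μ ν : ProbMeasure n} → Coupling μ ν → Carrier
  squaredCost {μ = μ} {ν} π = couplingLaw π (displacement μ ν)

  0≤squaredCost : {μ ν : ProbMeasure n} (π : Coupling μ ν) → 0# ≤ squaredCost π
  0≤squaredCost {n} π = nonneg (couplingLaw-integral π) λ _ → 0≤‖x‖² {n} _

  w₂-isInfimum : (μ ν : ProbMeasure n) →
    IsInfimum (λ x → ∃ λ (π : Coupling μ ν) → x ≈ transportCost π) (w₂ μ ν)
  w₂-isInfimum μ ν = proj₂ (infimum _ _ _)

  0≤w₂ : (μ ν : ProbMeasure n) → 0# ≤ w₂ μ ν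
  0≤w₂ μ ν = proj₂ (w₂-isInfimum μ ν) 0# λ x (π , x≈cost) →
    ≤.trans (√-nonNegative _) (≤.reflexive (sym x≈cost))

  w₂²≤squaredCost : {μ ν : ProbMeasure n} (π : Coupling μ ν) → (w₂ μ ν) ² ≤ squaredCost π
  w₂²≤squaredCost {μ = μ} {ν} π = begin
    (w₂ μ ν) ²            ≤⟨ ²-mono-≤ (0≤w₂ μ ν) (proj₁ (w₂-isInfimum μ ν) _ (π , refl)) ⟩
    (√ squaredCost π) ²   ≈⟨ √-² (0≤squaredCost π) ⟩
    squaredCost π         ∎

  -- `√ y` is a lower bound for all costs, hence for their infimum. The case of negative `y` does
  -- arise: the bounds supplied are `2#` minus an error that may exceed it.
  ≤-w₂² : ∀ {μ ν : ProbMeasure n} {y} → (∀ (π : Coupling μ ν) → y ≤ squaredCost π) → y ≤ (w₂ μ ν) ²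
  ≤-w₂² {μ = μ} {ν} {y} y≤ with ≤.total 0# y
  ... | inj₂ y≤0 = ≤.trans y≤0 (0≤x² _)
  ... | inj₁ 0≤y = begin
    y            ≈⟨ √-² 0≤y ⟨
    (√ y) ²      ≤⟨ ²-mono-≤ (√-nonNegative y) (proj₂ (w₂-isInfimum μ ν) (√ y) λ x (π , x≈cost) →
      ≤.trans (²-cancel-≤ (√-nonNegative _) (begin
        (√ y) ²               ≈⟨ √-² 0≤y ⟩
        y                     ≤⟨ y≤ π ⟩
        squaredCost π         ≈⟨ √-² (0≤squaredCost π) ⟨
        (√ squaredCost π) ²   ∎)) (≤.reflexive (sym x≈cost))) ⟩
    (w₂ μ ν) ²   ∎

  0≤normalisation : (μ : ProbMeasure n) → 0# ≤ normalisation μ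
  0≤normalisation μ = ⁻¹-nonNegative _ (√-nonNegative _)

  0≤indicator : ∀ (S : Subset n) i → 0# ≤ indicator S i
  0≤indicator S i with lookup S i
  ... | true  = 0≤1
  ... | false = ≤.refl

  commonSize : Subset n × Subset n → Carrier
  commonSize (S , T) = ‖ indicator (S ∩ T) ‖²

  module _ (μ ν : ProbMeasure n) where

    private
      A = normalisation μ
      B = normalisation ν

    -- The displacement with its cross term dropped. By normalisation its mean is 1 + 1 under every
    -- coupling, which is the origin of the 2 in the limit.
    separate : Subset n × Subset n → Carrier
    separate (S , T) = A ² * ‖ indicator S ‖² + B ² * ‖ indicator T ‖²

    displacement-≤ : ∀ ST → displacement μ ν ST ≤ separate ST
    displacement-≤ (S , T) = begin
      displacement μ ν (S , T)
        ≤⟨ mono (sum-integral n) (λ i → ≤-by (2# * (indicator S i * A * (indicator T i * B)))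
             (*-nonNegative (proj₁ 0<2) (*-nonNegative
               (*-nonNegative (0≤indicator S i) (0≤normalisation μ))
               (*-nonNegative (0≤indicator T i) (0≤normalisation ν))))
             (solve 4 (λ x a y b → a :* a :* (x :* x) :+ b :* b :* (y :* y) :=
               (x :* a :- y :* b) :* (x :* a :- y :* b) :+ :2 :* (x :* a :* (y :* b)))
               refl (indicator S i) A (indicator T i) B)) ⟩
      (sum λ i → A ² * (indicator S i) ² + B ² * (indicator T i) ²)
        ≈⟨ trans (+-homo (sum-integral n) _ _)
             (+-cong (*-homo (sum-integral n) _ _) (*-homo (sum-integral n) _ _)) ⟩
      separate (S , T)
        ∎

    -- The cross term 2AB is at most A² + B².
    separate-≤ : ∀ ST → separate ST ≤ displacement μ ν ST + (A ² + B ²) * commonSize ST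
    separate-≤ (S , T) = begin
      separate (S , T)
        ≈⟨ trans (+-homo (sum-integral n) _ _)
             (+-cong (*-homo (sum-integral n) _ _) (*-homo (sum-integral n) _ _)) ⟨
      (sum λ i → A ² * (indicator S i) ² + B ² * (indicator T i) ²)
        ≤⟨ mono (sum-integral n) coordinate ⟩
      (sum λ i → (normalized μ S i - normalized ν T i) ² + (A ² + B ²) * (indicator (S ∩ T) i) ²)
        ≈⟨ trans (+-homo (sum-integral n) _ _) (+-congˡ (*-homo (sum-integral n) _ _)) ⟩
      displacement μ ν (S , T) + (A ² + B ²) * commonSize (S , T)
        ∎
      where
      coordinate : ∀ i → A ² * (indicator S i) ² + B ² * (indicator T i) ² ≤
        (normalized μ S i - normalized ν T i) ² + (A ² + B ²) * (indicator (S ∩ T) i) ²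
      coordinate i rewrite lookup-zipWith _∧_ i S T with lookup S i | lookup T i
      ... | true  | true  = ≤-by ((A - B) ²) (0≤x² (A - B))
        (solve 2 (λ a b → (:1 :* a :- :1 :* b) :* (:1 :* a :- :1 :* b) :+ (a :* a :+ b :* b) :* (:1 :* :1)
          := a :* a :* (:1 :* :1) :+ b :* b :* (:1 :* :1) :+ (a :- b) :* (a :- b)) refl A B)
      ... | true  | false = ≤.reflexive
        (solve 2 (λ a b → a :* a :* (:1 :* :1) :+ b :* b :* (:0 :* :0)
          := (:1 :* a :- :0 :* b) :* (:1 :* a :- :0 :* b) :+ (a :* a :+ b :* b) :* (:0 :* :0)) refl A B)
      ... | false | true  = ≤.reflexive
        (solve 2 (λ a b → a :* a :* (:0 :* :0) :+ b :* b :* (:1 :* :1)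
          := (:0 :* a :- :1 :* b) :* (:0 :* a :- :1 :* b) :+ (a :* a :+ b :* b) :* (:0 :* :0)) refl A B)
      ... | false | false = ≤.reflexive
        (solve 2 (λ a b → a :* a :* (:0 :* :0) :+ b :* b :* (:0 :* :0)
          := (:0 :* a :- :0 :* b) :* (:0 :* a :- :0 :* b) :+ (a :* a :+ b :* b) :* (:0 :* :0)) refl A B)

    module _ (0<m : 0# < secondMoment μ) (0<m′ : 0# < secondMoment ν) (π : Coupling μ ν) where

      couplingLaw-separate : couplingLaw π separate ≈ 2#
      couplingLaw-separate = trans (+-homo (couplingLaw-integral π) _ _) (+-cong
        (trans (*-homo (couplingLaw-integral π) _ _)
          (trans (*-congˡ (couplingLaw-left π _)) (normalisation-² μ 0<m)))
        (trans (*-homo (couplingLaw-integral π) _ _)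
          (trans (*-congˡ (couplingLaw-right π _)) (normalisation-² ν 0<m′))))

      squaredCost-≤2 : squaredCost π ≤ 2#
      squaredCost-≤2 = ≤.trans (mono (couplingLaw-integral π) displacement-≤)
        (≤.reflexive couplingLaw-separate)

      2-≤squaredCost : 2# ≤ squaredCost π + (A ² + B ²) * couplingLaw π commonSize
      2-≤squaredCost = begin
        2#                              ≈⟨ couplingLaw-separate ⟨
        couplingLaw π separate          ≤⟨ mono (couplingLaw-integral π) separate-≤ ⟩
        (couplingLaw π λ ST → displacement μ ν ST + (A ² + B ²) * commonSize ST)
          ≈⟨ trans (+-homo (couplingLaw-integral π) _ _) (+-congˡ (*-homo (couplingLaw-integral π) _ _)) ⟩
        squaredCost π + (A ² + B ²) * couplingLaw π commonSize ∎

  swap : {μ ν : ProbMeasure n} → Coupling μ ν → Coupling ν μ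
  swap π = record
    { joint            = λ T S → joint π S T
    ; jointNonNegative = λ T S → jointNonNegative π S T
    ; marginalˡ        = marginalʳ π
    ; marginalʳ        = marginalˡ π
    }

  couplingLaw-swap-commonSize : {μ ν : ProbMeasure n} (π : Coupling μ ν) →
    couplingLaw π commonSize ≈ couplingLaw (swap π) commonSize
  couplingLaw-swap-commonSize {n} π = trans (fubini (∑⊆-integral n) (isLinear (∑⊆-integral n)) _)
    (∑⊆-cong {n} λ T → ∑⊆-cong {n} λ S → *-congˡ (reflexive
      (≡.cong (λ W → ‖ indicator W ‖²) (∩-comm S T))))

  joint-zero : {μ ν : ProbMeasure n} (π : Coupling μ ν) → ∀ S {T} → mass ν T ≈ 0# → joint π S T ≈ 0#
  joint-zero π S {T} massT≈0 = ≤.antisym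
    (≤.trans (term≤∑⊆ (λ S → jointNonNegative π S T) S) (≤.reflexive (trans (marginalʳ π T) massT≈0)))
    (jointNonNegative π S T)

  w₂²-≤2 : ∀ (G G′ : Graph (suc n)) → (w₂ (hardcore G) (hardcore G′)) ² ≤ 2#
  w₂²-≤2 G G′ = ≤.trans (w₂²≤squaredCost π)
    (squaredCost-≤2 _ _ (secondMoment-pos G) (secondMoment-pos G′) π)
    where π = independentCoupling (hardcore G) (hardcore G′)

  -- The overlap estimate for hardcore models.

  module Chaos {s} (s-probability : IsProbability s) {η} (0<η : 0# < η) (η≤1 : η ≤ 1#)
    (K : ℕ) (0<1-η : 0# < 1# - η) (1≤2κᴷ : 1# ≤ 2# * (1# - η) ^ K) where

    open Resample s-probability
    open ResampledPolynomial s-probability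
    open Damped 0<η η≤1

    -- If K w = t + d exceeds t, then η d κᵈ ≤ 1 ≤ (2 κᴷ)ʷ = 2ʷ κᵗ κᵈ.
    linear≤exponential : ∀ w t → η * ι (K ℕ.* w) ≤ η * ι t + 2# ^ w * κ ^ t
    linear≤exponential w t with ℕ.≤-total (K ℕ.* w) t
    ... | inj₁ Kw≤t = ≤.trans (*-monoˡ-≤ η (proj₁ 0<η) (ι-mono-≤ Kw≤t))
      (x≤x+y _ (*-nonNegative (^-nonNegative w (proj₁ 0<2)) (^-nonNegative t (proj₁ 0<1-η))))
    ... | inj₂ t≤Kw with ℕ.m≤n⇒∃[o]m+o≡n t≤Kw
    ...   | d , t+d≡Kw = begin
      η * ι (K ℕ.* w)                 ≡⟨ ≡.cong (λ k → η * ι k) (≡.sym t+d≡Kw) ⟩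
      η * ι (t ℕ.+ d)                 ≈⟨ trans (*-congˡ (×-homo-+ 1# t d)) (distribˡ η (ι t) (ι d)) ⟩
      η * ι t + η * ι d               ≤⟨ +-monoʳ-≤ (η * ι t) (*-cancelˡ-≤ (κ ^ d) (^-pos d 0<1-η) (begin
        κ ^ d * (η * ι d)                ≈⟨ *-congˡ (*-comm η (ι d)) ⟩
        κ ^ d * (ι d * η)                ≤⟨ ^-decay d (proj₁ 0<η) η≤1 ⟩
        1#                               ≤⟨ 1≤^ w 1≤2κᴷ ⟩
        (2# * κ ^ K) ^ w                 ≈⟨ ^-distrib-* 2# (κ ^ K) w ⟩
        2# ^ w * (κ ^ K) ^ w             ≈⟨ *-congˡ (^-assocʳ κ K w) ⟩
        2# ^ w * κ ^ (K ℕ.* w)           ≡⟨ ≡.cong (λ k → 2# ^ w * κ ^ k) (≡.sym t+d≡Kw) ⟩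
        2# ^ w * κ ^ (t ℕ.+ d)           ≈⟨ *-congˡ (^-homo-* κ t d) ⟩
        2# ^ w * (κ ^ t * κ ^ d)         ≈⟨ solve 3 (λ x y z → x :* (y :* z) := z :* (x :* y)) refl _ _ _ ⟩
        κ ^ d * (2# ^ w * κ ^ t)         ∎)) ⟩
      η * ι t + 2# ^ w * κ ^ t        ∎

    damped : Graph n → Subset n → Carrier
    damped G′ S = κ ^ ∣ S ∣ * independencePolynomial G′ (weight 1# S)

    commonSize-bound : ∀ (G′ : Graph n) S T → Independent G′ T →
      η * ι K * commonSize (S , T) ≤ η * ‖ indicator S ‖² + damped G′ S
    commonSize-bound G′ S T ind = begin
      η * ι K * commonSize (S , T)
        ≈⟨ trans (*-congˡ (‖indicator‖² W)) (trans (*-assoc η _ _) (*-congˡ (sym (×1-homo-* K ∣ W ∣)))) ⟩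
      η * ι (K ℕ.* ∣ W ∣)
        ≤⟨ linear≤exponential ∣ W ∣ ∣ S ∣ ⟩
      η * ι ∣ S ∣ + 2# ^ ∣ W ∣ * κ ^ ∣ S ∣
        ≤⟨ +-monoʳ-≤ _ (*-monoʳ-≤ _ (^-nonNegative ∣ S ∣ (proj₁ 0<1-η))
             (2^≤z G′ W W-ind (λ v → *-nonNegative 0≤1 (0≤indicator S v)) 1≤weight)) ⟩
      η * ι ∣ S ∣ + independencePolynomial G′ (weight 1# S) * κ ^ ∣ S ∣
        ≈⟨ +-cong (*-congˡ (sym (‖indicator‖² S))) (*-comm _ _) ⟩
      η * ‖ indicator S ‖² + damped G′ S
        ∎
      where
      W = S ∩ T
      W-ind : Independent G′ W
      W-ind i i∈W j j∈W = ind i (p∩q⊆q S T i∈W) j (p∩q⊆q S T j∈W)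
      1≤weight : ∀ v → v ∈ W → 1# ≤ weight 1# S v
      1≤weight v v∈W rewrite []=⇒lookup (p∩q⊆p S T v∈W) = ≤.reflexive (sym (*-identityˡ 1#))

    meanDamped : Graph n → Graph n → Carrier
    meanDamped G G′ = ∑⊆ λ S → mass (hardcore G) S * damped G′ S

    -- The pointwise bound does not involve `T`, so its mean sees only the first marginal. This
    -- makes the estimate uniform over couplings.
    couplingLaw-commonSize : ∀ (G G′ : Graph n) (π : Coupling (hardcore G) (hardcore G′)) →
      η * ι K * couplingLaw π commonSize ≤ η * secondMoment (hardcore G) + meanDamped G G′
    couplingLaw-commonSize {n} G G′ π = begin
      η * ι K * couplingLaw π commonSize
        ≈⟨ *-homo (couplingLaw-integral π) _ _ ⟨
      (couplingLaw π λ ST → η * ι K * commonSize ST)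
        ≤⟨ mono (∑⊆-integral n) (λ S → mono (∑⊆-integral n) λ T → term S T (independent? G′ T)) ⟩
      (couplingLaw π λ (S , T) → η * ‖ indicator S ‖² + damped G′ S)
        ≈⟨ couplingLaw-left π (λ S → η * ‖ indicator S ‖² + damped G′ S) ⟩
      (∑⊆ λ S → mass (hardcore G) S * (η * ‖ indicator S ‖² + damped G′ S))
        ≈⟨ (∑⊆-cong {n} λ S → solve 4 (λ m h x d → m :* (h :* x :+ d) := h :* (m :* x) :+ m :* d) refl _ η _ _) ⟩
      (∑⊆ λ S → η * (mass (hardcore G) S * ‖ indicator S ‖²) + mass (hardcore G) S * damped G′ S)
        ≈⟨ trans (+-homo (∑⊆-integral n) _ _) (+-congʳ (*-homo (∑⊆-integral n) _ _)) ⟩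
      η * secondMoment (hardcore G) + meanDamped G G′
        ∎
      where
      term : ∀ S T → Dec (Independent G′ T) →
        joint π S T * (η * ι K * commonSize (S , T)) ≤ joint π S T * (η * ‖ indicator S ‖² + damped G′ S)
      term S T (yes ind) = *-monoˡ-≤ _ (jointNonNegative π S T) (commonSize-bound G′ S T ind)
      term S T (no dependent) = ≤.reflexive (trans (vanish _) (sym (vanish _)))
        where
        vanish : ∀ x → joint π S T * x ≈ 0#
        vanish x = trans (*-congʳ (joint-zero π S (mass-zero G′ T dependent))) (zeroˡ x)

    -- `inverseSecondMoment G` depends on the first graph alone, so resampling averages only
    -- `meanDamped`, whose conditional mean is bounded.
    defect : Graph n → Graph n → Carrier
    defect G G′ = inverseSecondMoment G * meanDamped G G′

    normalised-commonSize : ∀ (G G′ : Graph (suc n)) (π : Coupling (hardcore G) (hardcore G′)) →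
      η * ι K * (inverseSecondMoment G * couplingLaw π commonSize) ≤ η + defect G G′
    normalised-commonSize G G′ π = rescale (0≤x² (normalisation (hardcore G)))
      (normalisation-² (hardcore G) (secondMoment-pos G)) (couplingLaw-commonSize G G′ π)
      where
      rescale : ∀ {h a m x y} → 0# ≤ a → a * m ≈ 1# → h * x ≤ η * m + y → h * (a * x) ≤ η + a * y
      rescale {h} {a} {m} {x} {y} 0≤a am≈1 hx≤ηm+y = begin
        h * (a * x)          ≈⟨ solve 3 (λ h a x → h :* (a :* x) := a :* (h :* x)) refl h a x ⟩
        a * (h * x)          ≤⟨ *-monoˡ-≤ a 0≤a hx≤ηm+y ⟩
        a * (η * m + y)      ≈⟨ solve 4 (λ a e m y → a :* (e :* m :+ y) := e :* (a :* m) :+ a :* y) refl a η m y ⟩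
        η * (a * m) + a * y  ≈⟨ +-congʳ (trans (*-congˡ am≈1) (*-identityʳ η)) ⟩
        η + a * y            ∎

    squaredCost-bound : ∀ (G G′ : Graph (suc n)) (π : Coupling (hardcore G) (hardcore G′)) →
      η * ι K * 2# ≤ η * ι K * squaredCost π + (2# * η + (defect G G′ + defect G′ G))
    squaredCost-bound G G′ π = combine (*-nonNegative (proj₁ 0<η) (ι-nonNegative K))
      (2-≤squaredCost (hardcore G) (hardcore G′) (secondMoment-pos G) (secondMoment-pos G′) π)
      (couplingLaw-swap-commonSize π) (normalised-commonSize G G′ π) (normalised-commonSize G′ G (swap π))
      where
      combine : ∀ {h q a b x x′ d d′} → 0# ≤ h → 2# ≤ q + (a + b) * x → x ≈ x′ →
        h * (a * x) ≤ η + d → h * (b * x′) ≤ η + d′ → h * 2# ≤ h * q + (2# * η + (d + d′))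
      combine {h} {q} {a} {b} {x} {x′} {d} {d′} 0≤h 2≤ x≈x′ hax≤ hbx≤ = begin
        h * 2#
          ≤⟨ *-monoˡ-≤ h 0≤h 2≤ ⟩
        h * (q + (a + b) * x)
          ≈⟨ solve 5 (λ h q a b x → h :* (q :+ (a :+ b) :* x) := h :* q :+ (h :* (a :* x) :+ h :* (b :* x)))
               refl h q a b x ⟩
        h * q + (h * (a * x) + h * (b * x))
          ≤⟨ +-monoʳ-≤ _ (+-mono-≤ hax≤ (≤.trans (≤.reflexive (*-congˡ (*-congˡ x≈x′))) hbx≤)) ⟩
        h * q + ((η + d) + (η + d′))
          ≈⟨ +-congˡ (solve 3 (λ e x y → (e :+ x) :+ (e :+ y) := :2 :* e :+ (x :+ y)) refl η d d′) ⟩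
        h * q + (2# * η + (d + d′))
          ∎

-- Averaging over the graphs, and the limit.

module Limit {c ℓ₁ ℓ₂} (ℝ : CompleteOrderedField c ℓ₁ ℓ₂) where

  open Real ℝ hiding (zero)
  open RingSolver ℝ
  open OrderedField ℝ
  open Laws ℝ
  open GraphPolynomials ℝ
  open Hardcore ℝ
  open Transport ℝ
  open Relation.Binary.Reasoning.PartialOrder (DecTotalOrder.poset decTotalOrder)

  private
    variable
      n : ℕ

  liminf-from-above : ∀ {a l} → (∀ n → 0# ≤ a n) → (∀ n → a n ≤ l) →
    (∀ δ → 0# < δ → Eventually λ n → l ≤ a n + δ) → IsLiminf a l
  liminf-from-above {a} {l} 0≤a a≤l eventually = upper , least
    where
    Tail : ℕ → Carrier → Set ℓ₁
    Tail n y = ∃ λ k → n ℕ.≤ k × y ≈ a k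

    upper : ∀ x → (∃ λ n → IsInfimum (Tail n) x) → x ≤ l
    upper x (n , lower , _) = ≤.trans (lower _ (n , ℕ.≤-refl , refl)) (a≤l n)

    tailInfimum : ∀ n → ∃ (IsInfimum (Tail n))
    tailInfimum n with infimum (λ y → Lift (c ⊔ ℓ₂) (Tail n y)) (_ , lift (n , ℕ.≤-refl , refl))
      (0# , λ { y (lift (k , _ , y≈)) → ≤.trans (0≤a k) (≤.reflexive (sym y≈)) })
    ... | i , lower , greatest = i , (λ y y∈ → lower y (lift y∈)) ,
      λ y y≤ → greatest y λ { z (lift z∈) → y≤ z z∈ }

    -- If y < l, the tail infima, which eventually exceed l - δ for
    -- δ = (l - y)/2, would exceed y.
    least : ∀ y → UpperBound (λ x → ∃ λ n → IsInfimum (Tail n) x) y → l ≤ y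
    least y y-bound with l ≤.≤? y
    ... | yes l≤y = l≤y
    ... | no  l≰y = contradiction (λ (N , l≤a) → conclude N l≤a) (eventually δ 0<δ)
      where
      gap = l - y
      δ = ½ * gap

      0<gap : 0# < gap
      0<gap = x≤y⇒0≤y-x (≰⇒≥ l≰y) , λ 0≈gap → l≰y (begin
        l          ≈⟨ solve 2 (λ t y → t := (t :- y) :+ y) refl l y ⟩
        gap + y    ≈⟨ trans (+-congʳ (sym 0≈gap)) (+-identityˡ y) ⟩
        y          ∎)

      0<δ = *-pos 0<½ 0<gap

      conclude : ∀ N → ¬ (∀ m → N ℕ.≤ m → l ≤ a m + δ)
      conclude N l≤a with tailInfimum N
      ... | i , i-infimum@(_ , greatest) = <⇒≱ 0<δ (begin
        δ                       ≈⟨ solve 2 (λ d t → d := (t :- d) :- (t :- (d :+ d))) refl δ l ⟩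
        (l - δ) - (l - (δ + δ)) ≤⟨ +-monoˡ-≤ _ (≤.trans (greatest (l - δ) below) (y-bound i (N , i-infimum))) ⟩
        y - (l - (δ + δ))       ≈⟨ +-congˡ (-‿cong (+-congˡ (-‿cong (halves gap)))) ⟩
        y - (l - gap)           ≈⟨ solve 2 (λ y t → y :- (t :- (t :- y)) := :0) refl y l ⟩
        0#                      ∎)
        where
        below : LowerBound (Tail N) (l - δ)
        below x (k , N≤k , x≈) = begin
          l - δ          ≤⟨ +-monoˡ-≤ (- δ) (l≤a k N≤k) ⟩
          a k + δ - δ    ≈⟨ solve 2 (λ a d → a :+ d :- d := a) refl _ δ ⟩
          a k            ≈⟨ x≈ ⟨
          x              ∎

  meanInverseSecondMoment : ℕ → Carrier
  meanInverseSecondMoment n = G[ n ,½] inverseSecondMoment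

  meanInverseSecondMoment-null : Null λ m → meanInverseSecondMoment (suc m)
  meanInverseSecondMoment-null ε 0<ε =
    -- With r = R + 1, this makes 2 at most r ε / 2; a mean count of at most ε / 4 then makes the
    -- other term 2 r ε / 4, the remaining half of r ε.
    archimedean-* 2# 0<½ε >>= λ (R , 2≤) →
    smallDominating-null (suc R) 0<1 ≤.refl (½ * (½ * ε)) (*-pos 0<½ 0<½ε) >>= λ (N , dom≤) →
    λ k → k (N , λ m N≤m → *-cancelˡ-≤ (ι (suc R)) (ι-pos R) (bound R m
      (2≤ (suc R) (ℕ.n≤1+n R)) (dom≤ (suc m) (ℕ.m≤n⇒m≤1+n N≤m))))
    where
    0<½ε = *-pos 0<½ 0<ε

    bound : ∀ R m → 2# ≤ ι (suc R) * (½ * ε) →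
      G[ suc m ,½] (smallDominating (suc R) 1#) ≤ ½ * (½ * ε) →
      ι (suc R) * meanInverseSecondMoment (suc m) ≤ ι (suc R) * ε
    bound R m 2≤ dom≤ = begin
      r * meanInverseSecondMoment (suc m)
        ≈⟨ *-homo (G-integral (suc m)) r inverseSecondMoment ⟨
      (G[ suc m ,½] λ G → r * inverseSecondMoment G)
        ≤⟨ mono (G-integral (suc m)) (inverseSecondMoment-bound (suc R)) ⟩
      (G[ suc m ,½] λ G → 2# + 2# * r * smallDominating (suc R) 1# G)
        ≈⟨ trans (+-homo (G-integral (suc m)) (λ _ → 2#) (λ G → 2# * r * smallDominating (suc R) 1# G))
             (+-cong (G-total (suc m) 2#)
               (*-homo (G-integral (suc m)) (2# * r) (smallDominating (suc R) 1#))) ⟩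
      2# + 2# * r * G[ suc m ,½] (smallDominating (suc R) 1#)
        ≤⟨ +-mono-≤ 2≤ (*-monoˡ-≤ (2# * r) (*-nonNegative (proj₁ 0<2) (ι-nonNegative (suc R))) dom≤) ⟩
      r * (½ * ε) + 2# * r * (½ * (½ * ε))
        ≈⟨ solve 3 (λ r h e → r :* (h :* e) :+ :2 :* r :* (h :* (h :* e)) :=
             r :* (h :* e :+ (h :* (h :* e) :+ h :* (h :* e)))) refl r ½ ε ⟩
      r * (½ * ε + (½ * (½ * ε) + ½ * (½ * ε)))
        ≈⟨ *-congˡ (trans (+-congˡ (halves (½ * ε))) (halves ε)) ⟩
      r * ε
        ∎
      where r = ι (suc R)

  module _ {s} (0<s : 0# < s) (s≤1 : s ≤ 1#) where

    private
      s-probability : IsProbability s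
      s-probability = proj₁ 0<s , s≤1

    open Resample s-probability
    open ResampledPolynomial s-probability

    pairLaw : ∀ n → Law (Graph n × Graph n)
    pairLaw n f = G[ n ,½] λ G → resample s G λ G′ → f (G , G′)

    pairLaw-integral : ∀ n → IsIntegral (pairLaw n)
    pairLaw-integral n = bind-integral (G-integral n) λ G → image-integral (G ,_) (resample-integral G)

    pairLaw-total : ∀ n → Total (pairLaw n)
    pairLaw-total n k = trans (cong (G-integral n) λ G → resample-total G k) (G-total n k)

    meanCost : ℕ → Carrier
    meanCost n = pairLaw n λ (G , G′) → (w₂ (hardcore G) (hardcore G′)) ²

    meanCost-≤2 : ∀ m → meanCost (suc m) ≤ 2#
    meanCost-≤2 m = ≤.trans (mono (pairLaw-integral (suc m)) λ (G , G′) → w₂²-≤2 G G′)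
      (≤.reflexive (pairLaw-total (suc m) 2#))

    0≤meanCost : ∀ n → 0# ≤ meanCost n
    0≤meanCost n = nonneg (pairLaw-integral n) λ (G , G′) → 0≤x² (w₂ (hardcore G) (hardcore G′))

    module Estimate {η} (0<η : 0# < η) (η≤1 : η ≤ 1#)
      (k : ℕ) (0<1-η : 0# < 1# - η) (1≤2κᴷ : 1# ≤ 2# * (1# - η) ^ suc k) where

      open Damped 0<η η≤1
      open Chaos s-probability 0<η η≤1 (suc k) 0<1-η 1≤2κᴷ

      meanDefect : ℕ → Carrier
      meanDefect n = pairLaw n λ (G , G′) → defect G G′

      meanDamped-bound : ∀ {C} → Bounded 1# C → ∀ (G : Graph n) →
        (resample s G λ G′ → meanDamped G G′) ≤ C
      meanDamped-bound {n} {C} bounded G = begin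
        (resample s G λ G′ → ∑⊆ λ S → mass (hardcore G) S * damped G′ S)
          ≈⟨ fubini (resample-integral G) (isLinear (∑⊆-integral n)) _ ⟩
        (∑⊆ λ S → resample s G λ G′ → mass (hardcore G) S * damped G′ S)
          ≈⟨ (∑⊆-cong {n} λ S → trans (*-homo (resample-integral G) _ _)
               (*-congˡ (*-homo (resample-integral G) _ _))) ⟩
        (∑⊆ λ S → mass (hardcore G) S * (κ ^ ∣ S ∣ * Ez G S 1#))
          ≤⟨ mono (∑⊆-integral n) (λ S → term S (independent? G S)) ⟩
        (∑⊆ λ S → mass (hardcore G) S * C)
          ≈⟨ IsLinear.*-homoʳ (isLinear (∑⊆-integral n)) (mass (hardcore G)) C ⟩
        ∑⊆ (mass (hardcore G)) * C
          ≈⟨ trans (*-congʳ (total (hardcore G))) (*-identityˡ C) ⟩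
        C
          ∎
        where
        term : ∀ S → Dec (Independent G S) →
          mass (hardcore G) S * (κ ^ ∣ S ∣ * Ez G S 1#) ≤ mass (hardcore G) S * C
        term S (yes ind)      = *-monoˡ-≤ _ (nonNegative (hardcore G) S) (bounded G S ind)
        term S (no dependent) = ≤.reflexive (trans (vanish _) (sym (vanish _)))
          where
          vanish : ∀ x → mass (hardcore G) S * x ≈ 0#
          vanish x = trans (*-congʳ (mass-zero G S dependent)) (zeroˡ x)

      meanDefect-bound : ∀ {C} → Bounded 1# C → ∀ n → meanDefect n ≤ C * meanInverseSecondMoment n
      meanDefect-bound {C} bounded n = begin
        (G[ n ,½] λ G → resample s G λ G′ → inverseSecondMoment G * meanDamped G G′)
          ≤⟨ mono (G-integral n) (λ G → begin
               (resample s G λ G′ → inverseSecondMoment G * meanDamped G G′)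
                 ≈⟨ *-homo (resample-integral G) (inverseSecondMoment G) (meanDamped G) ⟩
               inverseSecondMoment G * resample s G (meanDamped G)
                 ≤⟨ *-monoˡ-≤ _ (0≤x² _) (meanDamped-bound bounded G) ⟩
               inverseSecondMoment G * C
                 ≈⟨ *-comm _ C ⟩
               C * inverseSecondMoment G
                 ∎) ⟩
        (G[ n ,½] λ G → C * inverseSecondMoment G)
          ≈⟨ *-homo (G-integral n) C inverseSecondMoment ⟩
        C * meanInverseSecondMoment n
          ∎

      w₂²-bound : ∀ (G G′ : Graph (suc n)) →
        η * ι (suc k) * 2# ≤ η * ι (suc k) * (w₂ (hardcore G) (hardcore G′)) ² +
          (2# * η + (defect G G′ + defect G′ G))
      -- `≤-w₂²` asks for a lower bound free of the coupling, so the inequality is divided by η K,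
      -- passed to the infimum and multiplied back.
      w₂²-bound G G′ = divide (*-pos 0<η (ι-pos k)) (≤-w₂² {μ = hardcore G} {hardcore G′} λ π →
        multiplied (*-pos 0<η (ι-pos k)) (squaredCost-bound G G′ π))
        where
        split : ∀ {h x} → 0# < h → h * (2# - x * h ⁻¹) ≈ h * 2# - x
        split {h} {x} (_ , 0≉h) = trans
          (solve 3 (λ h x i → h :* (:2 :- x :* i) := h :* :2 :- h :* i :* x) refl h x (h ⁻¹))
          (+-congˡ (-‿cong (trans (*-congʳ (*-⁻¹-inverse h λ h≈0 → 0≉h (sym h≈0))) (*-identityˡ x))))

        multiplied : ∀ {h x q} → 0# < h → h * 2# ≤ h * q + x → 2# - x * h ⁻¹ ≤ q
        multiplied {h} {x} {q} 0<h h2≤ = *-cancelˡ-≤ h 0<h (begin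
          h * (2# - x * h ⁻¹)  ≈⟨ split 0<h ⟩
          h * 2# - x           ≤⟨ +-monoˡ-≤ (- x) h2≤ ⟩
          h * q + x - x        ≈⟨ solve 2 (λ y x → y :+ x :- x := y) refl (h * q) x ⟩
          h * q                ∎)

        divide : ∀ {h x w} → 0# < h → 2# - x * h ⁻¹ ≤ w → h * 2# ≤ h * w + x
        divide {h} {x} {w} 0<h ≤w = begin
          h * 2#                   ≈⟨ solve 2 (λ y x → y := y :- x :+ x) refl (h * 2#) x ⟩
          h * 2# - x + x           ≈⟨ +-congʳ (split 0<h) ⟨
          h * (2# - x * h ⁻¹) + x  ≤⟨ +-monoˡ-≤ x (*-monoˡ-≤ h (proj₁ 0<h) ≤w) ⟩
          h * w + x                ∎

      meanCost-bound : ∀ {C} → Bounded 1# C → ∀ m →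
        η * ι (suc k) * 2# ≤ η * ι (suc k) * meanCost (suc m) +
          (2# * η + 2# * (C * meanInverseSecondMoment (suc m)))
      meanCost-bound {C} bounded m = begin
        h * 2#
          ≈⟨ pairLaw-total (suc m) (h * 2#) ⟨
        pairLaw (suc m) (λ _ → h * 2#)
          ≤⟨ mono E (λ (G , G′) → w₂²-bound G G′) ⟩
        pairLaw (suc m) (λ (G , G′) → h * cost (G , G′) + (2# * η + (defect G G′ + defect G′ G)))
          ≈⟨ trans (+-homo E (λ p → h * cost p) (λ p → 2# * η + (defect₁ p + defect₂ p)))
               (+-cong (*-homo E h cost)
                 (trans (+-homo E (λ _ → 2# * η) (λ p → defect₁ p + defect₂ p))
                   (+-cong (pairLaw-total (suc m) (2# * η)) (+-homo E defect₁ defect₂)))) ⟩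
        h * meanCost (suc m) + (2# * η + (meanDefect (suc m) + pairLaw (suc m) λ (G , G′) → defect G′ G))
          -- The second defect has to be averaged conditionally on `G′`, the graph drawn last;
          -- detailed balance exchanges the roles.
          ≈⟨ +-congˡ (+-congˡ (+-congˡ (graph-reversible (suc m) λ G G′ → defect G′ G))) ⟩
        h * meanCost (suc m) + (2# * η + (meanDefect (suc m) + meanDefect (suc m)))
          ≤⟨ +-monoʳ-≤ _ (+-monoʳ-≤ _
               (+-mono-≤ (meanDefect-bound bounded (suc m)) (meanDefect-bound bounded (suc m)))) ⟩
        h * meanCost (suc m) + (2# * η + (C * i + C * i))
          ≈⟨ +-congˡ (+-congˡ (solve 1 (λ x → x :+ x := :2 :* x) refl (C * i))) ⟩
        h * meanCost (suc m) + (2# * η + 2# * (C * i))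
          ∎
        where
        h = η * ι (suc k)
        i = meanInverseSecondMoment (suc m)
        E = pairLaw-integral (suc m)
        cost defect₁ defect₂ : Graph (suc m) × Graph (suc m) → Carrier
        cost (G , G′)    = (w₂ (hardcore G) (hardcore G′)) ²
        defect₁ (G , G′) = defect G G′
        defect₂ (G , G′) = defect G′ G

      -- The order of choices matters: `K` and `η` come first, then `C`, which does not depend on
      -- the number of vertices, and only then is the graph taken large enough to bring the defect
      -- terms below `η`. The total error 3 η, divided by η K, is 3 / K, whence the hypothesis.
      meanCost-limit : ∀ {δ} → 0# < δ → 2# + 1# ≤ ι (suc k) * δ →
        Eventually λ m → 2# ≤ meanCost (suc m) + δ
      meanCost-limit {δ} 0<δ 3≤Kδ =
        bounded-unit 0<s >>= λ (C , 0≤C , bounded) →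
        -- The `1#` added to `2# * C` keeps the divisor positive even if `C` is zero.
        meanInverseSecondMoment-null (η * (2# * C + 1#) ⁻¹) (0<tolerance C 0≤C) >>= λ (N , small) →
        λ done → done (N , λ m N≤m → *-cancelˡ-≤ h 0<h (begin
          h * 2#
            ≤⟨ meanCost-bound bounded m ⟩
          h * meanCost (suc m) + (2# * η + 2# * (C * meanInverseSecondMoment (suc m)))
            ≤⟨ +-monoʳ-≤ _ (+-monoʳ-≤ _ (absorb C 0≤C (small m N≤m))) ⟩
          h * meanCost (suc m) + (2# * η + η)
            ≈⟨ +-congˡ (solve 1 (λ e → :2 :* e :+ e := e :* (:2 :+ :1)) refl η) ⟩
          h * meanCost (suc m) + η * (2# + 1#)
            ≤⟨ +-monoʳ-≤ _ (*-monoˡ-≤ η (proj₁ 0<η) 3≤Kδ) ⟩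
          h * meanCost (suc m) + η * (ι (suc k) * δ)
            ≈⟨ solve 4 (λ e k a d → e :* k :* a :+ e :* (k :* d) := e :* k :* (a :+ d)) refl η (ι (suc k)) _ δ ⟩
          h * (meanCost (suc m) + δ)
            ∎))
        where
        h = η * ι (suc k)
        0<h = *-pos 0<η (ι-pos k)

        0<2C+1 : ∀ C → 0# ≤ C → 0# < 2# * C + 1#
        0<2C+1 C 0≤C = <-≤-trans 0<1 (x≤y+x 1# (*-nonNegative (proj₁ 0<2) 0≤C))

        0<tolerance : ∀ C → 0# ≤ C → 0# < η * (2# * C + 1#) ⁻¹
        0<tolerance C 0≤C = *-pos 0<η (⁻¹-pos (0<2C+1 C 0≤C))

        absorb : ∀ C → 0# ≤ C → ∀ {e} → e ≤ η * (2# * C + 1#) ⁻¹ → 2# * (C * e) ≤ η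
        absorb C 0≤C {e} e≤ = begin
          2# * (C * e)           ≤⟨ *-monoˡ-≤ 2# (proj₁ 0<2) (*-monoˡ-≤ C 0≤C e≤) ⟩
          2# * (C * (η * i))     ≤⟨ ≤-by (η * i) (proj₁ (0<tolerance C 0≤C))
            (solve 3 (λ C e i → e :* ((:2 :* C :+ :1) :* i) := :2 :* (C :* (e :* i)) :+ e :* i) refl C η i) ⟩
          η * ((2# * C + 1#) * i)
            ≈⟨ *-congˡ (*-⁻¹-inverse _ λ ≈0 → proj₂ (0<2C+1 C 0≤C) (sym ≈0)) ⟩
          η * 1#                 ≈⟨ *-identityʳ η ⟩
          η                      ∎
          where i = (2# * C + 1#) ⁻¹

    meanCost-eventually : ∀ δ → 0# < δ → Eventually λ m → 2# ≤ meanCost (suc m) + δ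
    meanCost-eventually δ 0<δ = archimedean-* (2# + 1#) 0<δ >>= λ (k , 3≤) →
      Estimate.meanCost-limit (0<η k) (η≤1 k) k (0<1-η k) (1≤2κᴷ k) 0<δ (3≤ (suc k) (ℕ.n≤1+n k))
      where
      -- With K = k + 1 and η = 1 / (2K), Bernoulli's inequality gives κᴷ ≥ 1 - K η = 1/2, which is
      -- the condition 2 κᴷ ≥ 1.
      η : ℕ → Carrier
      η k = ½ * ι (suc k) ⁻¹

      0<η : ∀ k → 0# < η k
      0<η k = *-pos 0<½ (⁻¹-pos (ι-pos k))

      Kη≈½ : ∀ k → ι (suc k) * η k ≈ ½
      Kη≈½ k = trans (solve 3 (λ K h i → K :* (h :* i) := K :* i :* h) refl (ι (suc k)) ½ _)
        (trans (*-congʳ (*-⁻¹-inverse _ λ K≈0 → proj₂ (ι-pos k) (sym K≈0))) (*-identityˡ ½))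

      η≤½ : ∀ k → η k ≤ ½
      η≤½ k = begin
        η k               ≤⟨ ≤-by (ι k * η k) (*-nonNegative (ι-nonNegative k) (proj₁ (0<η k)))
          (solve 2 (λ k e → (:1 :+ k) :* e := e :+ k :* e) refl (ι k) (η k)) ⟩
        ι (suc k) * η k   ≈⟨ Kη≈½ k ⟩
        ½                 ∎

      η≤1 : ∀ k → η k ≤ 1#
      η≤1 k = ≤.trans (η≤½ k) ½≤1

      0<1-η : ∀ k → 0# < 1# - η k
      0<1-η k = <-≤-trans 0<½ (≤-by (½ - η k) (x≤y⇒0≤y-x (η≤½ k)) (trans (+-congʳ (sym 2*½≈1))
        (solve 2 (λ h e → :2 :* h :- e := h :+ (h :- e)) refl ½ (η k))))

      1≤2κᴷ : ∀ k → 1# ≤ 2# * (1# - η k) ^ suc k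
      1≤2κᴷ k = begin
        1#                            ≈⟨ 2*½≈1 ⟨
        2# * ½                        ≈⟨ *-congˡ (trans (+-congˡ (-‿cong (Kη≈½ k))) 1-½≈½) ⟨
        2# * (1# - ι (suc k) * η k)   ≤⟨ *-monoˡ-≤ 2# (proj₁ 0<2)
          (bernoulli-≤ (suc k) (proj₁ (0<η k)) (η≤1 k)) ⟩
        2# * (1# - η k) ^ suc k       ∎

    meanCost-liminf : IsLiminf (λ m → meanCost (suc m)) 2#
    meanCost-liminf = liminf-from-above (λ m → 0≤meanCost (suc m)) meanCost-≤2 meanCost-eventually

  constant-limit : ∀ l → Limit₀ (λ _ → l) l
  constant-limit l ε (0≤ε , 0≉ε) = 1# , 0<1 , λ _ _ _ _ →
    (≤-by ε 0≤ε (solve 2 (λ l e → l := l :- e :+ e) refl l ε) ,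
     λ l-ε≈l → 0≉ε (trans (sym (-‿inverseʳ l)) (trans (+-congˡ (-‿cong (sym l-ε≈l)))
       (solve 2 (λ l e → l :- (l :- e) := e) refl l ε)))) ,
    (x≤x+y l 0≤ε , λ l≈l+ε → 0≉ε (trans (sym (-‿inverseʳ l)) (trans (+-congʳ l≈l+ε)
      (solve 2 (λ l e → l :+ e :- l := e) refl l ε))))

theorem1p2 : ∀ {c ℓ₁ ℓ₂} (ℝ : CompleteOrderedField c ℓ₁ ℓ₂) →
    let open Real ℝ in
    ∃ λ (L : Carrier → Carrier) →
    (∀ s → 0# < s → s < 1# →
    IsLiminf
    (λ m → G[ suc m ,½] λ G → resample s G λ G′ → (w₂ (hardcore G) (hardcore G′)) ²)
    (L s))
    × Limit₀ L 2#
-- The liminf equals `2#` exactly at every `s` in the interval, so the outer limit is that of a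
-- constant.
theorem1p2 ℝ = (λ _ → 2#) , (λ s 0<s (s≤1 , _) → meanCost-liminf 0<s s≤1) , constant-limit 2#
  where
  open Real ℝ
  open Limit ℝ
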